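{- As formal power series in $x$ with coefficients in $\mathbb{Q}[s,t,u,v]$, $$D^{(\mathsf{cpk},\mathsf{cval},\mathsf{cdasc},\mathsf{cddes})}(s,t,u,v;x)=\frac{1}{1-st\,V\big(st,(u+v)/2;x\big)}.$$
   Context: Let $\mathfrak{D}_n$ be the set of derangements of $[n]=\{1,\dots,n\}$, i.e. permutations $\pi=\pi_1\cdots\pi_n$ (one-line notation, $\pi_i=\pi(i)$) with $\pi_i\ne i$ for all $i$. For a permutation $\pi$ of $[n]$, the letter $\pi_i$ is a cyclic peak if $i<\pi_i>\pi_{\pi_i}$, a cyclic valley if $i>\pi_i<\pi_{\pi_i}$, a cyclic double ascent if $i<\pi_i<\pi_{\pi_i}$, and a cyclic double descent if $i>\pi_i>\pi_{\pi_i}$. Let $\mathsf{cpk}(\pi),\mathsf{cval}(\pi),\mathsf{cdasc}(\pi),\mathsf{cddes}(\pi)$ be the numbers of cyclic peaks, cyclic valleys, cyclic double ascents and cyclic double descents of $\pi$, respectively. Define $$D^{(\mathsf{cpk},\mathsf{cval},\mathsf{cdasc},\mathsf{cddes})}(s,t,u,v;x)=1+\sum_{n=1}^\infty\Big(\sum_{\pi\in\mathfrak{D}_n}s^{\mathsf{cpk}(\pi)}t^{\mathsf{cval}(\pi)}u^{\mathsf{cdasc}(\pi)}v^{\mathsf{cddes}(\pi)}\Big)\frac{x^n}{n!}.$$ The bivariate Chebyshev polynomials of the second kind are defined by $U_0(s,t)=1$, $U_1(s,t)=2t$, and $U_n(s,t)=2tU_{n-1}(s,t)-sU_{n-2}(s,t)$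 for $n\ge2$. Define $V(s,t;x)=\sum_{n=0}^\infty U_n(s,t)\frac{x^{n+2}}{(n+2)!}$; $V(st,(u+v)/2;x)$ denotes the series obtained by substituting $st$ for the first argument $s$ and $(u+v)/2$ for the second argument $t$. -}

module Defs where

open import Algebra.Bundles using (CommutativeRing)
import Algebra.Properties.CommutativeSemigroup as CommutativeSemigroupProperties
import Algebra.Properties.Ring as RingProperties
import Algebra.Properties.Semiring.Exp as Exp
import Algebra.Properties.Semiring.Sum as Sum
open import Data.Fin.Base using (Fin; zero; suc; toℕ) renaming (_<_ to _<ᶠ_; _>_ to _>ᶠ_)
import Data.Fin.Properties as Finₚ
import Data.Integer.Base as ℤ
open import Data.List.Base
  using (List; []; _∷_; allFin; cartesianProductWith; filter; foldr; length; map)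
open import Data.List.Membership.Propositional using (_∈_)
open import Data.List.Membership.Propositional.Properties
  using (∈-allFin; ∈-cartesianProductWith⁺; ∈-filter⁺; ∈-filter⁻)
open import Data.List.Relation.Unary.Any using (here)
import Data.List.Relation.Unary.All as All
import Data.List.Relation.Unary.AllPairs as AllPairs
open import Data.List.Relation.Unary.Unique.Propositional using (Unique)
import Data.List.Relation.Unary.Unique.Propositional.Properties as Uniqueₚ
open import Data.Nat.Base using (ℕ; zero; suc; _∸_; _≤_; _!; s≤s)
import Data.Nat.Base as ℕ
import Data.Nat.Properties as ℕₚ
open import Data.Product.Base using (_×_; _,_; proj₂)
import Data.Rational.Base as ℚ
import Data.Rational.Properties as ℚₚ
open import Data.Vec.Base using (Vec; []; _∷_; lookup)
open import Data.Vec.Properties using (∷-injective)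
open import Function.Bundles using (_⇔_; mk⇔)
open import Function.Consequences.Propositional
  using (strictlySurjective⇒surjective; surjective⇒strictlySurjective)
open import Function.Definitions using (Bijective; Injective; Surjective)
import Level
open Level using (0ℓ)
open import Relation.Binary.PropositionalEquality.Core using (_≡_; _≢_)
import Relation.Binary.PropositionalEquality.Core as ≡
import Relation.Binary.Reasoning.Setoid as SetoidReasoning
open import Relation.Unary using (Decidable)
open import Relation.Nullary using (Dec; ¬?; yes; no; _×-dec_; _→-dec_)
open import Relation.Nullary.Decidable using (map′)

------------------------------------------------------------------------
-- Formal power series

module PowerSeries {c ℓ} (R : CommutativeRing c ℓ) where

  open CommutativeRing R hiding (zero)
  open Sum semiring using (sum; sum-cong-≋)
  private
    module +S = CommutativeSemigroupProperties +-commutativeSemigroup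

  Series : Set c
  Series = ℕ → Carrier

  infix  4 _≈ˢ_
  infixl 6 _+ˢ_
  infixl 7 _*ˢ_
  infix  8 -ˢ_

  _≈ˢ_ : Series → Series → Set ℓ
  f ≈ˢ g = ∀ n → f n ≈ g n

  _+ˢ_ : Series → Series → Series
  (f +ˢ g) n = f n + g n

  -ˢ_ : Series → Series
  (-ˢ f) n = - f n

  const : Carrier → Series
  const a zero    = a
  const a (suc n) = 0#

  0ˢ 1ˢ : Series
  0ˢ n = 0#
  1ˢ = const 1#

  -- The indeterminate.
  X : Series
  X 1 = 1#
  X _ = 0#

  _*ˢ_ : Series → Series → Series
  (f *ˢ g) n = sum {suc n} λ i → f (toℕ i) * g (n ∸ toℕ i)

  private
    tl : Series → Series
    tl f n = f (suc n)

  *ˢ-cong : ∀ {f f′ g g′} → f ≈ˢ f′ → g ≈ˢ g′ → f *ˢ g ≈ˢ f′ *ˢ g′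
  *ˢ-cong f≈ g≈ n = sum-cong-≋ {suc n} λ i → *-cong (f≈ (toℕ i)) (g≈ (n ∸ toℕ i))

  private
    open SetoidReasoning setoid

    *ˢ-suc : ∀ f g n → (f *ˢ g) (suc n) ≈ (f *ˢ tl g) n + f (suc n) * g 0
    *ˢ-suc f g zero = begin
      f 0 * g 1 + (f 1 * g 0 + 0#)  ≈⟨ +-congˡ (+-identityʳ _) ⟩
      f 0 * g 1 + f 1 * g 0         ≈⟨ +-congʳ (+-identityʳ _) ⟨
      f 0 * g 1 + 0# + f 1 * g 0    ∎
    *ˢ-suc f g (suc n) = begin
      f 0 * g (suc (suc n)) + (tl f *ˢ g) (suc n)
        ≈⟨ +-congˡ (*ˢ-suc (tl f) g n) ⟩
      f 0 * g (suc (suc n)) + ((tl f *ˢ tl g) n + f (suc (suc n)) * g 0)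
        ≈⟨ +-assoc _ _ _ ⟨
      f 0 * g (suc (suc n)) + (tl f *ˢ tl g) n + f (suc (suc n)) * g 0 ∎

  *ˢ-comm : ∀ f g → f *ˢ g ≈ˢ g *ˢ f
  *ˢ-comm f g zero = +-congʳ (*-comm (f 0) (g 0))
  *ˢ-comm f g (suc n) = begin
    f 0 * g (suc n) + (tl f *ˢ g) n  ≈⟨ +-cong (*-comm _ _) (*ˢ-comm (tl f) g n) ⟩
    g (suc n) * f 0 + (g *ˢ tl f) n  ≈⟨ +-comm _ _ ⟩
    (g *ˢ tl f) n + g (suc n) * f 0  ≈⟨ *ˢ-suc g f n ⟨
    (g *ˢ f) (suc n)                 ∎

  private
    scale : Carrier → Series → Series
    scale a f n = a * f n

    scale-*ˢ : ∀ a f g → scale a f *ˢ g ≈ˢ scale a (f *ˢ g)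
    scale-*ˢ a f g zero = begin
      a * f 0 * g 0 + 0#      ≈⟨ +-cong (*-assoc _ _ _) (sym (zeroʳ a)) ⟩
      a * (f 0 * g 0) + a * 0# ≈⟨ distribˡ _ _ _ ⟨
      a * (f 0 * g 0 + 0#)    ∎
    scale-*ˢ a f g (suc n) = begin
      a * f 0 * g (suc n) + (scale a (tl f) *ˢ g) n
        ≈⟨ +-cong (*-assoc _ _ _) (scale-*ˢ a (tl f) g n) ⟩
      a * (f 0 * g (suc n)) + a * (tl f *ˢ g) n
        ≈⟨ distribˡ _ _ _ ⟨
      a * (f 0 * g (suc n) + (tl f *ˢ g) n) ∎

  *ˢ-distribʳ : ∀ h f g → (f +ˢ g) *ˢ h ≈ˢ (f *ˢ h) +ˢ (g *ˢ h)
  *ˢ-distribʳ h f g zero = begin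
    (f 0 + g 0) * h 0 + 0#                   ≈⟨ +-cong (distribʳ _ _ _) (sym (+-identityˡ 0#)) ⟩
    (f 0 * h 0 + g 0 * h 0) + (0# + 0#)      ≈⟨ +S.interchange _ _ _ _ ⟩
    (f 0 * h 0 + 0#) + (g 0 * h 0 + 0#)      ∎
  *ˢ-distribʳ h f g (suc n) = begin
    (f 0 + g 0) * h (suc n) + ((tl f +ˢ tl g) *ˢ h) n
      ≈⟨ +-cong (distribʳ _ _ _) (*ˢ-distribʳ h (tl f) (tl g) n) ⟩
    (f 0 * h (suc n) + g 0 * h (suc n)) + ((tl f *ˢ h) n + (tl g *ˢ h) n)
      ≈⟨ +S.interchange _ _ _ _ ⟩
    (f *ˢ h) (suc n) + (g *ˢ h) (suc n) ∎

  *ˢ-distribˡ : ∀ h f g → h *ˢ (f +ˢ g) ≈ˢ (h *ˢ f) +ˢ (h *ˢ g)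
  *ˢ-distribˡ h f g n = begin
    (h *ˢ (f +ˢ g)) n          ≈⟨ *ˢ-comm h (f +ˢ g) n ⟩
    ((f +ˢ g) *ˢ h) n          ≈⟨ *ˢ-distribʳ h f g n ⟩
    (f *ˢ h) n + (g *ˢ h) n    ≈⟨ +-cong (*ˢ-comm f h n) (*ˢ-comm g h n) ⟩
    (h *ˢ f) n + (h *ˢ g) n    ∎

  *ˢ-assoc : ∀ f g h → (f *ˢ g) *ˢ h ≈ˢ f *ˢ (g *ˢ h)
  *ˢ-assoc f g h zero = +-congʳ (begin
    (f 0 * g 0 + 0#) * h 0  ≈⟨ *-congʳ (+-identityʳ _) ⟩
    f 0 * g 0 * h 0         ≈⟨ *-assoc _ _ _ ⟩
    f 0 * (g 0 * h 0)       ≈⟨ *-congˡ (+-identityʳ _) ⟨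
    f 0 * (g 0 * h 0 + 0#)  ∎)
  *ˢ-assoc f g h (suc n) = begin
    (f 0 * g 0 + 0#) * h (suc n) + ((scale (f 0) (tl g) +ˢ (tl f *ˢ g)) *ˢ h) n
      ≈⟨ +-cong (trans (*-congʳ (+-identityʳ _)) (*-assoc _ _ _))
                (*ˢ-distribʳ h (scale (f 0) (tl g)) (tl f *ˢ g) n) ⟩
    f 0 * (g 0 * h (suc n)) + ((scale (f 0) (tl g) *ˢ h) n + ((tl f *ˢ g) *ˢ h) n)
      ≈⟨ +-congˡ (+-cong (scale-*ˢ (f 0) (tl g) h n) (*ˢ-assoc (tl f) g h n)) ⟩
    f 0 * (g 0 * h (suc n)) + (f 0 * (tl g *ˢ h) n + (tl f *ˢ (g *ˢ h)) n)
      ≈⟨ +-assoc _ _ _ ⟨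
    f 0 * (g 0 * h (suc n)) + f 0 * (tl g *ˢ h) n + (tl f *ˢ (g *ˢ h)) n
      ≈⟨ +-congʳ (distribˡ _ _ _) ⟨
    f 0 * (g *ˢ h) (suc n) + (tl f *ˢ (g *ˢ h)) n ∎

  private
    0ˢ-*ˢ : ∀ g → 0ˢ *ˢ g ≈ˢ 0ˢ
    0ˢ-*ˢ g zero    = trans (+-identityʳ _) (zeroˡ _)
    0ˢ-*ˢ g (suc n) = trans (+-cong (zeroˡ _) (0ˢ-*ˢ g n)) (+-identityʳ _)

  *ˢ-identityˡ : ∀ f → 1ˢ *ˢ f ≈ˢ f
  *ˢ-identityˡ f zero    = trans (+-identityʳ _) (*-identityˡ _)
  *ˢ-identityˡ f (suc n) = trans (+-cong (*-identityˡ _) (0ˢ-*ˢ f n)) (+-identityʳ _)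

  commutativeRing : CommutativeRing c ℓ
  commutativeRing = record
    { Carrier = Series ; _≈_ = _≈ˢ_
    ; _+_ = _+ˢ_ ; _*_ = _*ˢ_ ; -_ = -ˢ_ ; 0# = 0ˢ ; 1# = 1ˢ
    ; isCommutativeRing = record
      { isRing = record
        { +-isAbelianGroup = record
          { isGroup = record
            { isMonoid = record
              { isSemigroup = record
                { isMagma = record
                  { isEquivalence = record
                    { refl  = λ _ → refl
                    ; sym   = λ p n → sym (p n)
                    ; trans = λ p q n → trans (p n) (q n)
                    }
                  ; ∙-cong = λ p q n → +-cong (p n) (q n)
                  }
                ; assoc = λ f g h n → +-assoc (f n) (g n) (h n)
                }
              ; identity = (λ f n → +-identityˡ (f n)) , (λ f n → +-identityʳ (f n))
              }
            ; inverse = (λ f n → -‿inverseˡ (f n)) , (λ f n → -‿inverseʳ (f n))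
            ; ⁻¹-cong = λ p n → -‿cong (p n)
            }
          ; comm = λ f g n → +-comm (f n) (g n)
          }
        ; *-cong = λ {f} {f′} {g} {g′} → *ˢ-cong {f} {f′} {g} {g′}
        ; *-assoc = *ˢ-assoc
        ; *-identity = *ˢ-identityˡ
                     , λ f n → trans (*ˢ-comm f 1ˢ n) (*ˢ-identityˡ f n)
        ; distrib = *ˢ-distribˡ , *ˢ-distribʳ
        }
      ; *-comm = *ˢ-comm
      }
    }

  -- Reciprocal of a series f with constant term 1, by the recursion
  --   g 0 = 1,   g (n + 1) = - Σ_{i ≤ n} f (i + 1) * g (n - i),
  -- where recipPrefix f n lists g n, g (n - 1), …, g 0.  For other f the value
  -- is meaningless.
  recipPrefix : Series → (n : ℕ) → Fin (suc n) → Carrier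
  recipPrefix f zero    _       = 1#
  recipPrefix f (suc n) zero    = - sum {suc n} λ i → f (suc (toℕ i)) * recipPrefix f n i
  recipPrefix f (suc n) (suc i) = recipPrefix f n i

  recip : Series → Series
  recip f n = recipPrefix f n zero

  recipPrefix-recip : ∀ f n i → recipPrefix f n i ≡ recip f (n ∸ toℕ i)
  recipPrefix-recip f zero    zero    = ≡.refl
  recipPrefix-recip f (suc n) zero    = ≡.refl
  recipPrefix-recip f (suc n) (suc i) = recipPrefix-recip f n i

  recip-inverseʳ : ∀ f → f 0 ≈ 1# → f *ˢ recip f ≈ˢ 1ˢ
  recip-inverseʳ f f0≈1 zero = trans (+-identityʳ _) (trans (*-identityʳ _) f0≈1)
  recip-inverseʳ f f0≈1 (suc n) = begin
    f 0 * recip f (suc n) + (tl f *ˢ recip f) n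
      ≈⟨ +-cong (trans (*-congʳ f0≈1) (*-identityˡ _))
                (sum-cong-≋ {suc n} λ i → *-congˡ {f (suc (toℕ i))} (reflexive (≡.sym (recipPrefix-recip f n i)))) ⟩
    recip f (suc n) + sum {suc n} (λ i → f (suc (toℕ i)) * recipPrefix f n i)
      ≈⟨ -‿inverseˡ _ ⟩
    0# ∎

------------------------------------------------------------------------
-- Polynomials in one indeterminate, as series with finitely many nonzero
-- coefficients

module Polynomial {c ℓ} (R : CommutativeRing c ℓ) where

  open CommutativeRing R
  open Sum semiring using (sum; sum-cong-≋; sum-replicate-zero)
  open RingProperties ring using (-0#≈0#)
  private
    module S  = PowerSeries R
    module SR = CommutativeRing S.commutativeRing

  record Poly : Set (c Level.⊔ ℓ) where
    field
      coeff     : ℕ → Carrier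
      bound     : ℕ
      vanishing : ∀ {n} → bound ≤ n → coeff n ≈ 0#
  open Poly public

  private
    0+0≈0 : ∀ {x y} → x ≈ 0# → y ≈ 0# → x + y ≈ 0#
    0+0≈0 p q = trans (+-cong p q) (+-identityˡ 0#)

    *-vanishing : ∀ (f g : S.Series) a b →
                  (∀ {n} → a ≤ n → f n ≈ 0#) → (∀ {n} → b ≤ n → g n ≈ 0#) →
                  ∀ {n} → a ℕ.+ b ≤ n → (f S.*ˢ g) n ≈ 0#
    *-vanishing f g a b f0 g0 {n} a+b≤n =
      trans (sum-cong-≋ {suc n} λ i → term (toℕ i)) (sum-replicate-zero (suc n))
      where
      term : ∀ i → f i * g (n ∸ i) ≈ 0#
      term i with a ℕₚ.≤? i
      ... | yes a≤i = trans (*-congʳ (f0 a≤i)) (zeroˡ _)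
      ... | no  a≰i = trans (*-congˡ (g0 b≤n∸i)) (zeroʳ _)
        where
        b≤n∸i : b ≤ n ∸ i
        b≤n∸i = ℕₚ.m+n≤o⇒m≤o∸n b (ℕₚ.≤-trans
          (ℕₚ.+-monoʳ-≤ b (ℕₚ.<⇒≤ (ℕₚ.≰⇒> a≰i)))
          (ℕₚ.≤-trans (ℕₚ.≤-reflexive (ℕₚ.+-comm b a)) a+b≤n))

  const : Carrier → Poly
  const a = record
    { coeff     = S.const a
    ; bound     = 1
    ; vanishing = λ { (s≤s _) → refl }
    }

  -- The indeterminate.
  X : Poly
  X = record
    { coeff     = S.X
    ; bound     = 2
    ; vanishing = λ { (s≤s (s≤s _)) → refl }
    }

  commutativeRing : CommutativeRing (c Level.⊔ ℓ) ℓ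
  commutativeRing = record
    { Carrier = Poly
    ; _≈_ = λ p q → coeff p SR.≈ coeff q
    ; _+_ = λ p q → record
      { coeff     = coeff p SR.+ coeff q
      ; bound     = bound p ℕ.⊔ bound q
      ; vanishing = λ b≤n → 0+0≈0
          (vanishing p (ℕₚ.≤-trans (ℕₚ.m≤m⊔n (bound p) (bound q)) b≤n))
          (vanishing q (ℕₚ.≤-trans (ℕₚ.m≤n⊔m (bound p) (bound q)) b≤n))
      }
    ; _*_ = λ p q → record
      { coeff     = coeff p SR.* coeff q
      ; bound     = bound p ℕ.+ bound q
      ; vanishing = *-vanishing (coeff p) (coeff q) (bound p) (bound q) (vanishing p) (vanishing q)
      }
    ; -_ = λ p → record
      { coeff     = SR.- coeff p
      ; bound     = bound p
      ; vanishing = λ b≤n → trans (-‿cong (vanishing p b≤n)) -0#≈0#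
      }
    ; 0# = record { coeff = SR.0# ; bound = 0 ; vanishing = λ _ → refl }
    ; 1# = const 1#
    ; isCommutativeRing = record
      { isRing = record
        { +-isAbelianGroup = record
          { isGroup = record
            { isMonoid = record
              { isSemigroup = record
                { isMagma = record
                  { isEquivalence = record
                    { refl  = λ _ → refl
                    ; sym   = λ p n → sym (p n)
                    ; trans = λ p q n → trans (p n) (q n)
                    }
                  ; ∙-cong = λ p q n → +-cong (p n) (q n)
                  }
                ; assoc = λ p q r → SR.+-assoc (coeff p) (coeff q) (coeff r)
                }
              ; identity = (λ p → SR.+-identityˡ (coeff p)) , (λ p → SR.+-identityʳ (coeff p))
              }
            ; inverse = (λ p → SR.-‿inverseˡ (coeff p)) , (λ p → SR.-‿inverseʳ (coeff p))
            ; ⁻¹-cong = λ p n → -‿cong (p n)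
            }
          ; comm = λ p q → SR.+-comm (coeff p) (coeff q)
          }
        ; *-cong = λ {p} {p′} {q} {q′} →
            SR.*-cong {coeff p} {coeff p′} {coeff q} {coeff q′}
        ; *-assoc = λ p q r → SR.*-assoc (coeff p) (coeff q) (coeff r)
        ; *-identity = (λ p → SR.*-identityˡ (coeff p)) , (λ p → SR.*-identityʳ (coeff p))
        ; distrib = (λ p q r → SR.distribˡ (coeff p) (coeff q) (coeff r))
                  , (λ p q r → SR.distribʳ (coeff p) (coeff q) (coeff r))
        }
      ; *-comm = λ p q → SR.*-comm (coeff p) (coeff q)
      }
    }

------------------------------------------------------------------------
-- ℚ[s,t,u,v], as ℚ[s][t][u][v], and ℚ[s,t,u,v]⟦x⟧

module ℚ[s]       = Polynomial ℚₚ.+-*-commutativeRing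
module ℚ[s,t]     = Polynomial ℚ[s].commutativeRing
module ℚ[s,t,u]   = Polynomial ℚ[s,t].commutativeRing
module ℚ[s,t,u,v] = Polynomial ℚ[s,t,u].commutativeRing

-- Opaque only so that the ring operations do not unfold during type checking.
opaque
  Coefficients : CommutativeRing 0ℓ 0ℓ
  Coefficients = ℚ[s,t,u,v].commutativeRing

open CommutativeRing Coefficients public
  using (_+_; _*_; _-_; 0#; 1#; semiring)
  renaming (Carrier to ℚ[s,t,u,v]; _≈_ to _≈ᶜ_)
open Exp semiring public using (_^_)

opaque
  unfolding Coefficients

  s t u v : ℚ[s,t,u,v]
  s = ℚ[s,t,u,v].const (ℚ[s,t,u].const (ℚ[s,t].const ℚ[s].X))
  t = ℚ[s,t,u,v].const (ℚ[s,t,u].const ℚ[s,t].X)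
  u = ℚ[s,t,u,v].const ℚ[s,t,u].X
  v = ℚ[s,t,u,v].X

  scalar : ℚ.ℚ → ℚ[s,t,u,v]
  scalar q = ℚ[s,t,u,v].const (ℚ[s,t,u].const (ℚ[s,t].const (ℚ[s].const q)))

½ 2# : ℚ[s,t,u,v]
½  = scalar ℚ.½
2# = scalar (ℤ.+ 2 ℚ./ 1)

open PowerSeries Coefficients public using (const; recip; recip-inverseʳ)
open PowerSeries Coefficients using (commutativeRing)
open CommutativeRing commutativeRing public
  using ()
  renaming ( Carrier to ℚ[s,t,u,v]⟦x⟧; _≈_ to _≈ˢ_; _+_ to _+ˢ_; _*_ to _*ˢ_
           ; _-_ to _-ˢ_; 1# to 1ˢ )

1/_! : ℕ → ℚ.ℚ
1/ n ! = ℤ.1ℤ ℚ./ (n !)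
  where instance _ = n ℕₚ.!≢0

-- Exponential generating function Σ a n * x^n / n!.
egf : (ℕ → ℚ[s,t,u,v]) → ℚ[s,t,u,v]⟦x⟧
egf a n = scalar (1/ n !) * a n

------------------------------------------------------------------------
-- Derangements.  A word π of length n over Fin n is the one-line notation of
-- the map i ↦ lookup π i; the letters 1,…,n are shifted to 0,…,n-1.

Word : ℕ → Set
Word n = Vec (Fin n) n

IsPermutation : ∀ {n} → Word n → Set
IsPermutation π = Bijective _≡_ _≡_ (lookup π)

IsDerangement : ∀ {n} → Word n → Set
IsDerangement π = IsPermutation π × (∀ i → lookup π i ≢ i)

module _ {n} (π : Word n) where

  injective? : Dec (Injective _≡_ _≡_ (lookup π))
  injective? = map′ (λ inj {i} {j} → inj i j) (λ inj i j → inj)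
    (Finₚ.all? λ i → Finₚ.all? λ j → (lookup π i Finₚ.≟ lookup π j) →-dec (i Finₚ.≟ j))

  surjective? : Dec (Surjective _≡_ _≡_ (lookup π))
  surjective? = map′ strictlySurjective⇒surjective surjective⇒strictlySurjective
    (Finₚ.all? λ j → Finₚ.any? λ i → lookup π i Finₚ.≟ j)

  isDerangement? : Dec (IsDerangement π)
  isDerangement? = (injective? ×-dec surjective?) ×-dec
                   Finₚ.all? λ i → ¬? (lookup π i Finₚ.≟ i)

allVecs : ∀ n m → List (Vec (Fin n) m)
allVecs n zero    = [] ∷ []
allVecs n (suc m) = cartesianProductWith _∷_ (allFin n) (allVecs n m)

derangements : ∀ n → List (Word n)
derangements n = filter isDerangement? (allVecs n n)

∈-allVecs : ∀ {n m} (w : Vec (Fin n) m) → w ∈ allVecs n m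
∈-allVecs []      = here ≡.refl
∈-allVecs (i ∷ w) = ∈-cartesianProductWith⁺ _∷_ (∈-allFin i) (∈-allVecs w)

allVecs-unique : ∀ n m → Unique (allVecs n m)
allVecs-unique n zero    = All.[] AllPairs.∷ AllPairs.[]
allVecs-unique n (suc m) =
  Uniqueₚ.cartesianProductWith⁺ _∷_ ∷-injective (Uniqueₚ.allFin⁺ n) (allVecs-unique n m)

∈-derangements : ∀ {n} {π : Word n} → π ∈ derangements n ⇔ IsDerangement π
∈-derangements {n} {π} = mk⇔
  (λ π∈ → proj₂ (∈-filter⁻ isDerangement? {xs = allVecs n n} π∈))
  (∈-filter⁺ isDerangement? (∈-allVecs π))

derangements-unique : ∀ n → Unique (derangements n)
derangements-unique n = Uniqueₚ.filter⁺ isDerangement? (allVecs-unique n n)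

module _ {n} (π : Word n) where

  private
    π⟨_⟩ : Fin n → Fin n
    π⟨ i ⟩ = lookup π i

  -- The conditions on the letter π i, for i an index.
  CyclicPeak CyclicValley CyclicDoubleAscent CyclicDoubleDescent : Fin n → Set
  CyclicPeak          i = i <ᶠ π⟨ i ⟩ × π⟨ i ⟩ >ᶠ π⟨ π⟨ i ⟩ ⟩
  CyclicValley        i = i >ᶠ π⟨ i ⟩ × π⟨ i ⟩ <ᶠ π⟨ π⟨ i ⟩ ⟩
  CyclicDoubleAscent  i = i <ᶠ π⟨ i ⟩ × π⟨ i ⟩ <ᶠ π⟨ π⟨ i ⟩ ⟩
  CyclicDoubleDescent i = i >ᶠ π⟨ i ⟩ × π⟨ i ⟩ >ᶠ π⟨ π⟨ i ⟩ ⟩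

  cyclicPeak? : Decidable CyclicPeak
  cyclicPeak? i = (i Finₚ.<? π⟨ i ⟩) ×-dec (π⟨ π⟨ i ⟩ ⟩ Finₚ.<? π⟨ i ⟩)

  cyclicValley? : Decidable CyclicValley
  cyclicValley? i = (π⟨ i ⟩ Finₚ.<? i) ×-dec (π⟨ i ⟩ Finₚ.<? π⟨ π⟨ i ⟩ ⟩)

  cyclicDoubleAscent? : Decidable CyclicDoubleAscent
  cyclicDoubleAscent? i = (i Finₚ.<? π⟨ i ⟩) ×-dec (π⟨ i ⟩ Finₚ.<? π⟨ π⟨ i ⟩ ⟩)

  cyclicDoubleDescent? : Decidable CyclicDoubleDescent
  cyclicDoubleDescent? i = (π⟨ i ⟩ Finₚ.<? i) ×-dec (π⟨ π⟨ i ⟩ ⟩ Finₚ.<? π⟨ i ⟩)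

  cpk cval cdasc cddes : ℕ
  cpk   = length (filter cyclicPeak? (allFin n))
  cval  = length (filter cyclicValley? (allFin n))
  cdasc = length (filter cyclicDoubleAscent? (allFin n))
  cddes = length (filter cyclicDoubleDescent? (allFin n))

weight : ∀ {n} → Word n → ℚ[s,t,u,v]
weight π = s ^ cpk π * t ^ cval π * u ^ cdasc π * v ^ cddes π

D : ℚ[s,t,u,v]⟦x⟧
D = egf λ where
  zero      → 1#
  n@(suc _) → foldr _+_ 0# (map weight (derangements n))

------------------------------------------------------------------------
-- Bivariate Chebyshev polynomials of the second kind, evaluated at elements
-- of ℚ[s,t,u,v]

U : ℕ → ℚ[s,t,u,v] → ℚ[s,t,u,v] → ℚ[s,t,u,v]
U zero          a b = 1#
U (suc zero)    a b = 2# * b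
U (suc (suc n)) a b = 2# * b * U (suc n) a b - a * U n a b

V : ℚ[s,t,u,v] → ℚ[s,t,u,v] → ℚ[s,t,u,v]⟦x⟧
V a b = egf λ where
  (suc (suc n)) → U n a b
  _             → 0#

-- The reciprocal of 1 - a V(b,c;x) is thus a genuine one.
1-aV-constant-term : ∀ a b c → (1ˢ -ˢ const a *ˢ V b c) 0 ≈ᶜ 1#
1-aV-constant-term a b c = begin
  1# - (a * (scalar (1/ 0 !) * 0#) + 0#)  ≈⟨ +-congˡ (-‿cong aV₀≈0) ⟩
  1# - 0#                                 ≈⟨ +-congˡ -0#≈0# ⟩
  1# + 0#                                 ≈⟨ +-identityʳ 1# ⟩
  1#                                      ∎
  where
  open CommutativeRing Coefficients
    using (setoid; ring; +-congˡ; -‿cong; *-congˡ; +-identityʳ; zeroʳ; trans)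
  open RingProperties ring using (-0#≈0#)
  open SetoidReasoning setoid
  aV₀≈0 : a * (scalar (1/ 0 !) * 0#) + 0# ≈ᶜ 0#
  aV₀≈0 = trans (+-identityʳ _) (trans (*-congˡ {a} (zeroʳ (scalar (1/ 0 !)))) (zeroʳ a))

module Submission where

-- Every permutation of [n+1] arises exactly once from one of [n] by shifting
-- the letters and inserting a new minimum, as a fixed point or on an arc
-- i → π i.  Give each letter a power series weight according to its type: S for
-- peaks, T for valleys, A and B for double ascents and descents, Y for fixed
-- points.  Put p = st, h = u + v, W = pV and K = V′/(1 - W).  Then W″ = p + hW′ - pW
-- gives K′ = 1 + hK + pK², and the choice
--   S = s,  T = tK′,  Y = pK,  A = u + Y,  B = v + Y,  G = 1/(1 - W)
-- satisfies A′ = B′ = Y′ = TS, S′ = 0, T′ = T(A + B), G′ = YG.  By the product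
-- rule these equations say that differentiating G ∏ weight(letter), for a fixed
-- π, sums the same expression over all insertions into π.  So the n-th
-- derivative of G is its sum over the permutations of [n]; at x = 0 the weights
-- become s, t, u, v, and 0 for fixed points, which leaves the derangements.

open import Algebra.Bundles using (CommutativeRing)
import Algebra.Properties.CommutativeMonoid.Mult as CommutativeMonoidMult
import Algebra.Properties.CommutativeMonoid.Sum as CommutativeMonoidSum
import Algebra.Properties.CommutativeSemigroup as CommutativeSemigroupProperties
import Algebra.Properties.Group as GroupProperties
import Algebra.Properties.Ring as RingProperties
import Algebra.Properties.Semiring.Mult as SemiringMult
import Algebra.Properties.Semiring.Sum as SemiringSum
import Algebra.Solver.Ring.NaturalCoefficients.Default as RingSolver
open import Data.Bool.Base using (Bool; true; false; _∧_; if_then_else_)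
open import Data.Fin.Base using (Fin; zero; suc; toℕ)
open import Data.Fin.Permutation using (_⟨$⟩ˡ_; inverseʳ)
import Data.Fin.Properties as Finₚ
import Data.Integer.Base as ℤ
import Data.Integer.Properties as ℤₚ
open import Data.List.Base as List
  using (List; []; _∷_; allFin; cartesianProductWith; filter; length)
open import Data.List.Membership.Propositional using (_∈_)
open import Data.List.Membership.Propositional.Properties
  using (∈-allFin; ∈-cartesianProductWith⁺; ∈-cartesianProductWith⁻; ∈-filter⁺; ∈-filter⁻)
open import Data.List.Membership.Propositional.Properties.WithK using (unique∧set⇒bag)
open import Data.List.Relation.Binary.BagAndSetEquality using (∼bag⇒↭)
open import Data.List.Relation.Binary.Permutation.Propositional as ↭ using (_↭_)
import Data.List.Relation.Unary.All as All
import Data.List.Relation.Unary.AllPairs as AllPairs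
open import Data.List.Relation.Unary.Any using (here; there)
open import Data.List.Relation.Unary.Unique.Propositional using (Unique)
import Data.List.Relation.Unary.Unique.Propositional.Properties as Uniqueₚ
open import Data.Nat.Base using (ℕ; zero; suc; _∸_; _!)
import Data.Nat.Base as ℕ
open import Data.Nat.GeneralisedArithmetic using (fold)
import Data.Nat.Properties as ℕₚ
open import Data.Product.Base using (∃; _×_; _,_; proj₁; proj₂)
import Data.Rational.Base as ℚ
import Data.Rational.Properties as ℚₚ
import Data.Rational.Unnormalised.Base as ℚᵘ
import Data.Rational.Unnormalised.Properties as ℚᵘₚ
open import Data.Vec.Base using (Vec; []; _∷_; lookup; map; tabulate; _[_]≔_)
open import Data.Vec.Functional using (Vector)
open import Data.Vec.Properties
  using ( ∷-injective; lookup-map; lookup∘update; lookup∘update′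
        ; lookup∘tabulate; tabulate∘lookup; tabulate-cong)
open import Defs using (Word; IsPermutation; module PowerSeries)
open import Function.Base using (_∘_; flip; id)
open import Function.Bundles using (mk⤖; mk⇔; module Equivalence)
open import Function.Consequences.Propositional
  using (strictlySurjective⇒surjective; surjective⇒strictlySurjective)
open import Function.Definitions using (Injective; StrictlySurjective)
open import Function.Properties.Bijection using (⤖⇒↔)
open import Function.Properties.Inverse using (↔-sym)
import Level
import Relation.Binary.Reasoning.Setoid as SetoidReasoning
open import Relation.Binary.PropositionalEquality as ≡ using (_≡_; _≢_)
open import Relation.Nullary using (¬_; yes; no; does; contradiction)
open import Relation.Nullary.Decidable using (decidable-stable)
open import Relation.Unary using (Decidable)

-- Generating permutations by inserting a new minimum

lookup-ext : ∀ {a} {A : Set a} {n} {xs ys : Vec A n} → (∀ i → lookup xs i ≡ lookup ys i) → xs ≡ ys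
lookup-ext {xs = xs} {ys} eq =
  ≡.trans (≡.sym (tabulate∘lookup xs)) (≡.trans (tabulate-cong eq) (tabulate∘lookup ys))

-- insert (suc k) puts the new letter zero between k and π k.
insert : ∀ {n} → Fin (suc n) → Word n → Word (suc n)
insert zero    π = zero ∷ map suc π
insert (suc k) π = suc (lookup π k) ∷ (map suc π [ k ]≔ zero)

module _ {n} (π : Word n) where

  insert-zero : ∀ i → lookup (insert zero π) (suc i) ≡ suc (lookup π i)
  insert-zero i = lookup-map i suc π

  insert-≡ : ∀ k → lookup (insert (suc k) π) (suc k) ≡ zero
  insert-≡ k = lookup∘update k (map suc π) zero

  insert-≢ : ∀ {i k} → i ≢ k → lookup (insert (suc k) π) (suc i) ≡ suc (lookup π i)
  insert-≢ {i} i≢k = ≡.trans (lookup∘update′ i≢k (map suc π) zero) (lookup-map i suc π)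

-- The place of the letter `zero` determines `k`. The letters of the shorter word are then read off
-- in place, except the one at `k`, which was moved to the head.
insert-injective : ∀ {n} {k l} {π ρ : Word n} → insert k π ≡ insert l ρ → k ≡ l × π ≡ ρ
insert-injective {k = zero}  {zero}  {π} {ρ} eq =
  ≡.refl , lookup-ext λ i → Finₚ.suc-injective (≡.trans (≡.sym (lookup-map i suc π))
    (≡.trans (≡.cong (flip lookup (suc i)) eq) (lookup-map i suc ρ)))
insert-injective {k = zero}  {suc l} eq with () ← proj₁ (∷-injective eq)
insert-injective {k = suc k} {zero}  eq with () ← proj₁ (∷-injective eq)
insert-injective {k = suc k} {suc l} {π} {ρ} eq with k Finₚ.≟ l
... | no k≢l = contradiction
        (≡.trans (≡.sym (insert-≡ π k)) (≡.trans (≡.cong (flip lookup (suc k)) eq) (insert-≢ ρ k≢l)))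
        λ ()
... | yes ≡.refl = ≡.refl , lookup-ext same
  where
  same : ∀ i → lookup π i ≡ lookup ρ i
  same i with i Finₚ.≟ k
  ... | yes ≡.refl = Finₚ.suc-injective (proj₁ (∷-injective eq))
  ... | no i≢k   = Finₚ.suc-injective
          (≡.trans (≡.sym (insert-≢ π i≢k)) (≡.trans (≡.cong (flip lookup (suc i)) eq) (insert-≢ ρ i≢k)))

-- Generated by insertion, so that a sum over words of length `suc n` is a double sum over shorter
-- words and places of insertion.
permutations : ∀ n → List (Word n)
permutations zero    = [] ∷ []
permutations (suc n) = cartesianProductWith (flip insert) (permutations n) (allFin (suc n))

permutations-unique : ∀ n → Unique (permutations n)
permutations-unique zero    = All.[] AllPairs.∷ AllPairs.[]
permutations-unique (suc n) =
  Uniqueₚ.cartesianProductWith⁺ (flip insert)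
    (λ eq → proj₂ (insert-injective eq) , proj₁ (insert-injective eq))
    (permutations-unique n) (Uniqueₚ.allFin⁺ (suc n))

-- Strict surjectivity supplies each preimage with a single plain equation, the form used in the
-- insertion arguments.
StrictPermutation : ∀ {n} → Word n → Set
StrictPermutation π = Injective _≡_ _≡_ (lookup π) × StrictlySurjective _≡_ (lookup π)

insert-injective⁺ : ∀ {n} k {π : Word n} →
  Injective _≡_ _≡_ (lookup π) → Injective _≡_ _≡_ (lookup (insert k π))
insert-injective⁺ zero {π} inj {zero} {zero} _ = ≡.refl
insert-injective⁺ zero {π} inj {zero} {suc j} eq with () ← ≡.trans eq (lookup-map j suc π)
insert-injective⁺ zero {π} inj {suc i} {zero} eq with () ← ≡.trans (≡.sym eq) (lookup-map i suc π)
insert-injective⁺ zero {π} inj {suc i} {suc j} eq = ≡.cong suc (inj (Finₚ.suc-injective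
  (≡.trans (≡.sym (lookup-map i suc π)) (≡.trans eq (lookup-map j suc π)))))
insert-injective⁺ (suc k) {π} inj {i} {j} = go i j
  where
  -- By injectivity, `suc (lookup π k)` could recur only at place `suc k`, which now holds `zero`.
  head≢ : ∀ i → lookup (insert (suc k) π) (suc i) ≢ suc (lookup π k)
  head≢ i eq with i Finₚ.≟ k
  ... | yes ≡.refl with () ← ≡.trans (≡.sym (insert-≡ π k)) eq
  ... | no i≢k   = i≢k (inj (Finₚ.suc-injective (≡.trans (≡.sym (insert-≢ π i≢k)) eq)))
  go : ∀ i j → lookup (insert (suc k) π) i ≡ lookup (insert (suc k) π) j → i ≡ j
  go zero    zero    _  = ≡.refl
  go zero    (suc j) eq = contradiction (≡.sym eq) (head≢ j)
  go (suc i) zero    eq = contradiction eq (head≢ i)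
  go (suc i) (suc j) eq with i Finₚ.≟ k | j Finₚ.≟ k
  ... | yes ≡.refl | yes ≡.refl = ≡.refl
  ... | yes ≡.refl | no j≢k with () ← ≡.trans (≡.sym (insert-≡ π k)) (≡.trans eq (insert-≢ π j≢k))
  ... | no i≢k | yes ≡.refl with () ← ≡.trans (≡.sym (insert-≡ π k)) (≡.trans (≡.sym eq) (insert-≢ π i≢k))
  ... | no i≢k | no j≢k = ≡.cong suc (inj (Finₚ.suc-injective
          (≡.trans (≡.sym (insert-≢ π i≢k)) (≡.trans eq (insert-≢ π j≢k)))))

-- Only the letter `suc (lookup π k)` loses its old place, and it is found again at the head.
insert-surjective⁺ : ∀ {n} k {π : Word n} →
  StrictlySurjective _≡_ (lookup π) → StrictlySurjective _≡_ (lookup (insert k π))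
insert-surjective⁺ zero sur zero = zero , ≡.refl
insert-surjective⁺ zero {π} sur (suc j) with i , ≡.refl ← sur j = suc i , lookup-map i suc π
insert-surjective⁺ (suc k) {π} sur zero = suc k , insert-≡ π k
insert-surjective⁺ (suc k) {π} sur (suc j) with i , ≡.refl ← sur j | i Finₚ.≟ k
... | yes ≡.refl = zero , ≡.refl
... | no i≢k   = suc i , insert-≢ π i≢k

∈-permutations⁻ : ∀ {n} {π : Word n} → π ∈ permutations n → StrictPermutation π
∈-permutations⁻ {zero}  (here ≡.refl) = (λ { {()} }) , λ ()
∈-permutations⁻ {suc n} π∈ with ∈-cartesianProductWith⁻ (flip insert) (permutations n) (allFin (suc n)) π∈
... | ρ , k , ρ∈ , _ , ≡.refl =
  insert-injective⁺ k (proj₁ (∈-permutations⁻ ρ∈)) , insert-surjective⁺ k (proj₂ (∈-permutations⁻ ρ∈))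

-- The default `d` fills the place vacated by `zero`; in `uninsert` it is the letter that the
-- insertion had moved to the head.
pred-or : ∀ {n} → Fin n → Fin (suc n) → Fin n
pred-or d zero    = d
pred-or d (suc i) = i

-- A fixed minimum is simply removed. Otherwise the minimum lies on a path `suc k` → `zero` →
-- `suc a`, and removing it joins the two halves into the arc `k` → `a`.
uninsert : ∀ {n} (π : Word (suc n)) → StrictPermutation π →
           ∃ λ k → ∃ λ ρ → insert k ρ ≡ π × StrictPermutation ρ
uninsert (zero ∷ w) (inj , sur) = zero , ρ , ≡.cong (zero ∷_) (lookup-ext ρ-spec) , inj′ , sur′
  where
  ρ-at : ∀ i → ∃ λ j → lookup w i ≡ suc j
  ρ-at i with lookup w i in eq
  ... | suc j = j , ≡.refl
  ... | zero with () ← inj {suc i} {zero} eq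
  ρ = tabulate (proj₁ ∘ ρ-at)
  ρ-suc : ∀ i → lookup w i ≡ suc (lookup ρ i)
  ρ-suc i = ≡.trans (proj₂ (ρ-at i)) (≡.cong suc (≡.sym (lookup∘tabulate (proj₁ ∘ ρ-at) i)))
  ρ-spec : ∀ i → lookup (map suc ρ) i ≡ lookup w i
  ρ-spec i = ≡.trans (lookup-map i suc ρ) (≡.sym (ρ-suc i))
  inj′ : Injective _≡_ _≡_ (lookup ρ)
  inj′ {i} {j} eq = Finₚ.suc-injective
    (inj {suc i} {suc j} (≡.trans (ρ-suc i) (≡.trans (≡.cong suc eq) (≡.sym (ρ-suc j)))))
  sur′ : StrictlySurjective _≡_ (lookup ρ)
  sur′ j with sur (suc j)
  ... | suc i , eq = i , Finₚ.suc-injective (≡.trans (≡.sym (ρ-suc i)) eq)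
uninsert {n} π@(suc a ∷ w) (inj , sur) with sur zero
... | suc k , πk≡0 = suc k , ρ , lookup-ext ρ-spec , inj′ , sur′
  where
  ρ = tabulate (pred-or a ∘ lookup w)
  ρ-at : ∀ i → lookup ρ i ≡ pred-or a (lookup w i)
  ρ-at = lookup∘tabulate (pred-or a ∘ lookup w)
  ρ-k : lookup ρ k ≡ a
  ρ-k = ≡.trans (ρ-at k) (≡.cong (pred-or a) πk≡0)
  ρ-≢ : ∀ {i} → i ≢ k → lookup w i ≡ suc (lookup ρ i)
  ρ-≢ {i} i≢k with lookup w i in eq | ρ-at i
  ... | suc j | e = ≡.cong suc (≡.sym e)
  ... | zero  | _ = contradiction (Finₚ.suc-injective (inj {suc i} {suc k} (≡.trans eq (≡.sym πk≡0)))) i≢k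
  ρ-spec : ∀ i → lookup (insert (suc k) ρ) i ≡ lookup π i
  ρ-spec zero = ≡.cong suc ρ-k
  ρ-spec (suc i) with i Finₚ.≟ k
  ... | yes ≡.refl = ≡.trans (insert-≡ ρ k) (≡.sym πk≡0)
  ... | no i≢k   = ≡.trans (insert-≢ ρ i≢k) (≡.sym (ρ-≢ i≢k))
  inj′ : Injective _≡_ _≡_ (lookup ρ)
  inj′ {i} {j} eq with i Finₚ.≟ k | j Finₚ.≟ k
  ... | yes ≡.refl | yes ≡.refl = ≡.refl
  ... | yes ≡.refl | no j≢k
    with () ← inj {zero} {suc j} (≡.trans (≡.cong suc (≡.trans (≡.sym ρ-k) eq)) (≡.sym (ρ-≢ j≢k)))
  ... | no i≢k | yes ≡.refl
    with () ← inj {zero} {suc i} (≡.trans (≡.cong suc (≡.trans (≡.sym ρ-k) (≡.sym eq))) (≡.sym (ρ-≢ i≢k)))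
  ... | no i≢k | no j≢k = Finₚ.suc-injective
          (inj {suc i} {suc j} (≡.trans (ρ-≢ i≢k) (≡.trans (≡.cong suc eq) (≡.sym (ρ-≢ j≢k)))))
  sur′ : StrictlySurjective _≡_ (lookup ρ)
  sur′ j with sur (suc j)
  ... | zero  , eq = k , ≡.trans ρ-k (Finₚ.suc-injective eq)
  ... | suc i , eq with i Finₚ.≟ k
  ...   | yes ≡.refl with () ← ≡.trans (≡.sym πk≡0) eq
  ...   | no i≢k   = i , Finₚ.suc-injective (≡.trans (≡.sym (ρ-≢ i≢k)) eq)

∈-permutations⁺ : ∀ {n} {π : Word n} → StrictPermutation π → π ∈ permutations n
∈-permutations⁺ {zero}  {[]} _ = here ≡.refl
∈-permutations⁺ {suc n} {π} perm with uninsert π perm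
... | k , ρ , ≡.refl , perm′ =
  ∈-cartesianProductWith⁺ (flip insert) (∈-permutations⁺ perm′) (∈-allFin k)

-- Derivations and the insertion of a new minimum

data Direction : Set where
  asc desc loop : Direction

-- By structural recursion, shifting both ends by `suc` leaves the direction definitionally
-- unchanged.
direction : ∀ {m n} → Fin m → Fin n → Direction
direction zero    zero    = loop
direction zero    (suc j) = asc
direction (suc i) zero    = desc
direction (suc i) (suc j) = direction i j

direction-refl : ∀ {n} (i : Fin n) → direction i i ≡ loop
direction-refl zero    = ≡.refl
direction-refl (suc i) = direction-refl i

loop⇒≡ : ∀ {n} (i j : Fin n) → direction i j ≡ loop → i ≡ j
loop⇒≡ zero    zero    _  = ≡.refl
loop⇒≡ (suc i) (suc j) eq = ≡.cong suc (loop⇒≡ i j eq)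

arc : ∀ {n} → Word n → Fin n → Direction
arc π i = direction i (lookup π i)

module Derivations {c ℓ} (R : CommutativeRing c ℓ) where

  open CommutativeRing R hiding (zero)
  open CommutativeMonoidSum +-commutativeMonoid using (sum; sum-cong-≋; ∑-distrib-+; sum-permute)
  open CommutativeMonoidSum *-commutativeMonoid
    using () renaming (sum to product; sum-cong-≋ to product-cong)
  open RingSolver commutativeSemiring using (solve; _:+_; _:*_; _:=_)
  open CommutativeSemigroupProperties *-commutativeSemigroup using (x∙yz≈y∙xz)
  open CommutativeSemigroupProperties +-commutativeSemigroup
    using () renaming (x∙yz≈y∙xz to x+yz≈y+xz)
  open SetoidReasoning setoid

  -- Products with one factor omitted, and sums over lists

  productExcept : ∀ {n} → Vector Carrier n → Fin n → Carrier
  productExcept f zero    = product (f ∘ suc)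
  productExcept f (suc i) = f zero * productExcept (f ∘ suc) i

  product-split : ∀ {n} (f : Vector Carrier n) i → product f ≈ f i * productExcept f i
  product-split f zero    = refl
  product-split f (suc i) = begin
    f zero * product (f ∘ suc)
      ≈⟨ *-congˡ (product-split (f ∘ suc) i) ⟩
    f zero * (f (suc i) * productExcept (f ∘ suc) i)
      ≈⟨ x∙yz≈y∙xz _ _ _ ⟩
    f (suc i) * (f zero * productExcept (f ∘ suc) i) ∎

  productExcept-cong : ∀ {n} {f g : Vector Carrier n} i →
    (∀ j → j ≢ i → f j ≈ g j) → productExcept f i ≈ productExcept g i
  productExcept-cong zero    f≈g = product-cong λ j → f≈g (suc j) λ ()
  productExcept-cong (suc i) f≈g = *-cong (f≈g zero λ ())
    (productExcept-cong i λ j j≢i → f≈g (suc j) (j≢i ∘ Finₚ.suc-injective))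

  -- Spelled with `foldr` and `map` to agree definitionally with the sum in `D` of the theorem.
  listSum : ∀ {a} {A : Set a} → (A → Carrier) → List A → Carrier
  listSum f xs = List.foldr _+_ 0# (List.map f xs)

  listSum-cong : ∀ {a} {A : Set a} {f g : A → Carrier} xs →
    (∀ {x} → x ∈ xs → f x ≈ g x) → listSum f xs ≈ listSum g xs
  listSum-cong []       f≈g = refl
  listSum-cong (x ∷ xs) f≈g = +-cong (f≈g (here ≡.refl)) (listSum-cong xs (f≈g ∘ there))

  listSum-++ : ∀ {a} {A : Set a} (f : A → Carrier) xs ys →
    listSum f (xs List.++ ys) ≈ listSum f xs + listSum f ys
  listSum-++ f []       ys = sym (+-identityˡ _)
  listSum-++ f (x ∷ xs) ys = trans (+-congˡ (listSum-++ f xs ys)) (sym (+-assoc _ _ _))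

  listSum-tabulate : ∀ {a} {A : Set a} (f : A → Carrier) {n} (g : Fin n → A) →
    listSum f (List.tabulate g) ≈ sum (f ∘ g)
  listSum-tabulate f {zero}  g = refl
  listSum-tabulate f {suc n} g = +-congˡ (listSum-tabulate f (g ∘ suc))

  listSum-map : ∀ {a b} {A : Set a} {B : Set b} (f : B → Carrier) (g : A → B) xs →
    listSum f (List.map g xs) ≈ listSum (f ∘ g) xs
  listSum-map f g []       = refl
  listSum-map f g (x ∷ xs) = +-congˡ (listSum-map f g xs)

  listSum-cartesianProductWith : ∀ {a b d} {A : Set a} {B : Set b} {D : Set d}
    (f : D → Carrier) (g : A → B → D) xs ys →
    listSum f (cartesianProductWith g xs ys) ≈ listSum (λ x → listSum (λ y → f (g x y)) ys) xs
  listSum-cartesianProductWith f g []       ys = refl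
  listSum-cartesianProductWith f g (x ∷ xs) ys = trans (listSum-++ f (List.map (g x) ys) _)
    (+-cong (listSum-map f (g x) ys) (listSum-cartesianProductWith f g xs ys))

  listSum-↭ : ∀ {a} {A : Set a} (f : A → Carrier) {xs ys} → xs ↭ ys → listSum f xs ≈ listSum f ys
  listSum-↭ f ↭.refl          = refl
  listSum-↭ f (↭.prep x p)    = +-congˡ (listSum-↭ f p)
  listSum-↭ f (↭.swap x y p)  = trans (x+yz≈y+xz _ _ _) (+-congˡ (+-congˡ (listSum-↭ f p)))
  listSum-↭ f (↭.trans p q)   = trans (listSum-↭ f p) (listSum-↭ f q)

  listSum-filter : ∀ {a p} {A : Set a} {P : A → Set p} (P? : Decidable P) (f : A → Carrier) xs →
    (∀ {x} → x ∈ xs → ¬ P x → f x ≈ 0#) → listSum f (List.filter P? xs) ≈ listSum f xs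
  listSum-filter P? f []       f≈0 = refl
  listSum-filter P? f (x ∷ xs) f≈0 with P? x
  ... | yes _  = +-congˡ (listSum-filter P? f xs (f≈0 ∘ there))
  ... | no ¬Px = trans (listSum-filter P? f xs (f≈0 ∘ there))
                       (sym (trans (+-congʳ (f≈0 (here ≡.refl) ¬Px)) (+-identityˡ _)))

  -- Derivations of a commutative ring

  record IsDerivation (∂ : Carrier → Carrier) : Set (c Level.⊔ ℓ) where
    field
      ∂-cong : ∀ {x y} → x ≈ y → ∂ x ≈ ∂ y
      ∂-+    : ∀ x y → ∂ (x + y) ≈ ∂ x + ∂ y
      ∂-*    : ∀ x y → ∂ (x * y) ≈ ∂ x * y + x * ∂ y

    ∂-0 : ∂ 0# ≈ 0#
    ∂-0 = GroupProperties.identityʳ-unique +-group (∂ 0#) (∂ 0#)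
      (trans (sym (∂-+ 0# 0#)) (∂-cong (+-identityˡ 0#)))

    ∂-1 : ∂ 1# ≈ 0#
    ∂-1 = GroupProperties.identityʳ-unique +-group (∂ 1#) (∂ 1#) (begin
      ∂ 1# + ∂ 1#            ≈⟨ +-cong (*-identityʳ _) (*-identityˡ _) ⟨
      ∂ 1# * 1# + 1# * ∂ 1#  ≈⟨ ∂-* 1# 1# ⟨
      ∂ (1# * 1#)            ≈⟨ ∂-cong (*-identityˡ 1#) ⟩
      ∂ 1#                   ∎)

    ∂-listSum : ∀ {a} {A : Set a} (f : A → Carrier) xs → ∂ (listSum f xs) ≈ listSum (∂ ∘ f) xs
    ∂-listSum f []       = ∂-0
    ∂-listSum f (x ∷ xs) = trans (∂-+ _ _) (+-congˡ (∂-listSum f xs))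

    ∂-product : ∀ {n} (f : Vector Carrier n) →
      ∂ (product f) ≈ sum λ i → ∂ (f i) * productExcept f i
    ∂-product {zero}  f = ∂-1
    ∂-product {suc n} f = trans (∂-* _ _) (+-congˡ (begin
      f zero * ∂ (product (f ∘ suc))
        ≈⟨ *-congˡ (∂-product (f ∘ suc)) ⟩
      f zero * sum (λ i → ∂ (f (suc i)) * productExcept (f ∘ suc) i)
        ≈⟨ *-distribˡ-sum {n} (f zero) _ ⟩
      sum (λ i → f zero * (∂ (f (suc i)) * productExcept (f ∘ suc) i))
        ≈⟨ sum-cong-≋ {n} (λ i → x∙yz≈y∙xz (f zero) _ _) ⟩
      sum (λ i → ∂ (f (suc i)) * (f zero * productExcept (f ∘ suc) i)) ∎))
      where open SemiringSum semiring using (*-distribˡ-sum)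

  -- Each equation lists what a letter becomes when an arc charged to it is cut, with a factor `T`
  -- because the new minimum is a valley. A peak keeps its type under either cut, hence `∂ S ≈ 0#`.
  -- The equation for `D` accounts for a new minimum that is a fixed point.
  module Insertion {∂ : Carrier → Carrier} (isDerivation : IsDerivation ∂)
    (A B S T Y D : Carrier)
    (∂A : ∂ A ≈ T * S) (∂B : ∂ B ≈ T * S) (∂S : ∂ S ≈ 0#) (∂T : ∂ T ≈ T * A + T * B)
    (∂Y : ∂ Y ≈ T * S) (∂D : ∂ D ≈ Y * D) where

    open IsDerivation isDerivation

    -- The weight of a letter, given the directions of the arcs entering and
    -- leaving it.
    letterWeight : Direction → Direction → Carrier
    letterWeight asc  asc  = A
    letterWeight asc  desc = S
    letterWeight desc asc  = T
    letterWeight desc desc = B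
    letterWeight loop loop = Y
    letterWeight _    _    = 0#

    weights : ∀ {n} → Word n → Vector Carrier n
    weights π i = letterWeight (arc π i) (arc π (lookup π i))

    -- Subdividing an arc by the new minimum makes its first half a descent and
    -- its second half an ascent.  So an ascending arc affects the letter it
    -- leaves, a descending arc the letter it enters.
    fromDescent fromAscent fromLoop : Direction → Direction → Carrier
    fromDescent desc e = T * letterWeight asc e
    fromDescent _    _ = 0#
    fromAscent e asc = T * letterWeight e desc
    fromAscent _ _   = 0#
    fromLoop loop loop = T * S
    fromLoop _    _    = 0#

    -- Sorts the differential equations by the arc that is cut. Pairs mixing `loop` with another
    -- direction do not occur in a permutation; their weight `0#` lets the identity hold for them as
    -- well.
    ∂-letterWeight : ∀ d e →
      ∂ (letterWeight d e) ≈ fromDescent d e + fromAscent d e + fromLoop d e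
    ∂-letterWeight asc  asc  = trans ∂A (sym (trans (+-identityʳ _) (+-identityˡ _)))
    ∂-letterWeight asc  desc = trans ∂S (sym (trans (+-identityʳ _) (+-identityˡ _)))
    ∂-letterWeight asc  loop = trans ∂-0 (sym (trans (+-identityʳ _) (+-identityˡ _)))
    ∂-letterWeight desc asc  = trans ∂T (sym (+-identityʳ _))
    ∂-letterWeight desc desc = trans ∂B (sym (trans (+-identityʳ _) (+-identityʳ _)))
    ∂-letterWeight desc loop =
      trans ∂-0 (sym (trans (+-identityʳ _) (trans (+-identityʳ _) (zeroʳ T))))
    ∂-letterWeight loop asc  =
      trans ∂-0 (sym (trans (+-identityʳ _) (trans (+-identityˡ _) (zeroʳ T))))
    ∂-letterWeight loop desc = trans ∂-0 (sym (trans (+-identityʳ _) (+-identityˡ _)))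
    ∂-letterWeight loop loop = trans ∂Y (sym (trans (+-congʳ (+-identityˡ _)) (+-identityˡ _)))

    product-insert-zero : ∀ {n} (π : Word n) →
      product (weights (insert zero π)) ≈ Y * product (weights π)
    product-insert-zero π = *-congˡ (product-cong λ i → reflexive (shift i))
      where
      shift : ∀ i → weights (insert zero π) (suc i) ≡ weights π i
      shift i rewrite insert-zero π i | insert-zero π (lookup π i) = ≡.refl

    module _ {n} (π : Word n) (π∈ : π ∈ permutations n) where

      private
        inj = proj₁ (∈-permutations⁻ π∈)
        sur = proj₂ (∈-permutations⁻ π∈)
        P = ⤖⇒↔ (mk⤖ (inj , strictlySurjective⇒surjective sur))

        w = weights π
        rest = productExcept w

        π⁻¹ : Fin n → Fin n
        π⁻¹ k = P ⟨$⟩ˡ k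

        π-π⁻¹ : ∀ k → lookup π (π⁻¹ k) ≡ k
        π-π⁻¹ k = inverseʳ P

        descentTerm ascentTerm loopTerm : Fin n → Carrier
        descentTerm i = fromDescent (arc π i) (arc π (lookup π i)) * rest i
        ascentTerm  i = fromAscent  (arc π i) (arc π (lookup π i)) * rest i
        loopTerm    i = fromLoop    (arc π i) (arc π (lookup π i)) * rest i

      module _ (k : Fin n) where

        private
          out : Fin n → Direction
          out i = arc (insert (suc k) π) (suc i)

          out-≡ : out k ≡ desc
          out-≡ = ≡.cong (direction (suc k)) (insert-≡ π k)

          out-≢ : ∀ {i} → i ≢ k → out i ≡ arc π i
          out-≢ i≢k = ≡.cong (direction (suc _)) (insert-≢ π i≢k)

          -- Leaving arcs are already updated, entering arcs still old: the cut changes the entering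
          -- arc only at index `k`, which is treated separately.
          w′ : Vector Carrier n
          w′ i = letterWeight (arc π i) (out (lookup π i))

          w′-≡ : ∀ {i} → lookup π i ≢ k → w′ i ≈ w i
          w′-≡ {i} πi≢k = reflexive (≡.cong (letterWeight (arc π i)) (out-≢ πi≢k))

        -- The head now carries the old letter at `k`, entered by the ascent from the minimum, and
        -- place `suc k` carries the minimum, a valley. Every other place keeps its entering arc.
        product-insert-suc : product (weights (insert (suc k) π)) ≈
          T * (letterWeight asc (out (lookup π k)) * productExcept w′ k)
        product-insert-suc = begin
          a * product f                     ≈⟨ *-congˡ (product-split f k) ⟩
          a * (f k * productExcept f k)
            ≈⟨ *-congˡ (*-cong f-k (productExcept-cong k f-≢)) ⟩
          a * (T * productExcept w′ k)
            ≈⟨ x∙yz≈y∙xz _ _ _ ⟩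
          T * (a * productExcept w′ k)      ∎
          where
          a = letterWeight asc (out (lookup π k))
          f : Vector Carrier n
          f i = weights (insert (suc k) π) (suc i)
          f-k : f k ≈ T
          f-k rewrite insert-≡ π k = refl
          f-≢ : ∀ i → i ≢ k → f i ≈ w′ i
          f-≢ i i≢k rewrite insert-≢ π i≢k = refl

        -- The letter at `k` is still entered by an ascent, so its weight fits back into the product
        -- of `w′`. What changes is the letter `k` itself, at place `π⁻¹ k`: its leaving arc now
        -- descends.
        product-insert-asc : arc π k ≡ asc →
          product (weights (insert (suc k) π)) ≈ ascentTerm (π⁻¹ k)
        product-insert-asc k-asc = trans product-insert-suc (begin
          T * (letterWeight asc (out (lookup π k)) * productExcept w′ k)
            ≡⟨ ≡.cong (λ d → T * (letterWeight d (out (lookup π k)) * productExcept w′ k)) k-asc ⟨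
          T * (w′ k * productExcept w′ k)
            ≈⟨ *-congˡ (trans (sym (product-split w′ k)) (product-split w′ q)) ⟩
          T * (w′ q * productExcept w′ q)
            ≈⟨ *-assoc _ _ _ ⟨
          T * w′ q * productExcept w′ q
            ≈⟨ *-cong (reflexive T*w′) (productExcept-cong q λ i i≢q →
                 w′-≡ λ πi≡k → i≢q (inj (≡.trans πi≡k (≡.sym (π-π⁻¹ k))))) ⟩
          ascentTerm q ∎)
          where
          q = π⁻¹ k
          T*w′ : T * w′ q ≡ fromAscent (arc π q) (arc π (lookup π q))
          T*w′ rewrite π-π⁻¹ k | k-asc | out-≡ = ≡.refl

        -- The arc out of `k` still descends, so all leaving directions are as before; only the
        -- letter at `k` changes, being now entered by an ascent.
        product-insert-desc : arc π k ≡ desc →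
          product (weights (insert (suc k) π)) ≈ descentTerm k
        product-insert-desc k-desc = trans product-insert-suc (begin
          T * (letterWeight asc (out (lookup π k)) * productExcept w′ k)
            ≈⟨ *-assoc _ _ _ ⟨
          T * letterWeight asc (out (lookup π k)) * productExcept w′ k
            ≈⟨ *-cong (reflexive T*w) (productExcept-cong k λ i _ →
                 reflexive (≡.cong (letterWeight (arc π i)) (out≡arc (lookup π i)))) ⟩
          descentTerm k ∎)
          where
          out≡arc : ∀ i → out i ≡ arc π i
          out≡arc i with i Finₚ.≟ k
          ... | yes ≡.refl = ≡.trans out-≡ (≡.sym k-desc)
          ... | no i≢k     = out-≢ i≢k
          T*w : T * letterWeight asc (out (lookup π k)) ≡ fromDescent (arc π k) (arc π (lookup π k))
          T*w rewrite out≡arc (lookup π k) | k-desc = ≡.refl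

        -- Here `k` is fixed, so the cut arc both enters and leaves the letter `k`, which becomes a
        -- peak.
        product-insert-loop : arc π k ≡ loop →
          product (weights (insert (suc k) π)) ≈ loopTerm k
        product-insert-loop k-loop = trans product-insert-suc (begin
          T * (letterWeight asc (out (lookup π k)) * productExcept w′ k)
            ≈⟨ *-assoc _ _ _ ⟨
          T * letterWeight asc (out (lookup π k)) * productExcept w′ k
            ≈⟨ *-cong (reflexive T*S) (productExcept-cong k λ i i≢k →
                 w′-≡ λ πi≡k → i≢k (inj (≡.trans πi≡k (≡.sym πk≡k)))) ⟩
          loopTerm k ∎)
          where
          πk≡k : lookup π k ≡ k
          πk≡k = ≡.sym (loop⇒≡ k (lookup π k) k-loop)
          T*S : T * letterWeight asc (out (lookup π k)) ≡ fromLoop (arc π k) (arc π (lookup π k))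
          T*S = ≡.trans (≡.cong (λ j → T * letterWeight asc (out j)) πk≡k)
            (≡.trans (≡.cong (λ d → T * letterWeight asc d) out-≡)
              (≡.sym (≡.trans (≡.cong (fromLoop (arc π k)) (≡.cong (arc π) πk≡k))
                (≡.cong₂ fromLoop k-loop k-loop))))

        descentTerm-vanishes : arc π k ≢ desc → descentTerm k ≈ 0#
        descentTerm-vanishes k≢ with arc π k
        ... | asc  = zeroˡ _
        ... | loop = zeroˡ _
        ... | desc = contradiction ≡.refl k≢

        ascentTerm-vanishes : arc π k ≢ asc → ascentTerm (π⁻¹ k) ≈ 0#
        ascentTerm-vanishes k≢ rewrite π-π⁻¹ k with arc π k
        ... | desc = zeroˡ _
        ... | loop = zeroˡ _
        ... | asc  = contradiction ≡.refl k≢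

        loopTerm-vanishes : arc π k ≢ loop → loopTerm k ≈ 0#
        loopTerm-vanishes k≢ with arc π k
        ... | asc  = zeroˡ _
        ... | desc = zeroˡ _
        ... | loop = contradiction ≡.refl k≢

        -- The direction of the arc out of `k` selects one of the three terms and the other two
        -- vanish. The ascent term sits at `π⁻¹ k`, the place of the letter that the arc leaves.
        product-insert : product (weights (insert (suc k) π)) ≈
          descentTerm k + ascentTerm (π⁻¹ k) + loopTerm k
        product-insert = by (arc π k) ≡.refl
          where
          differ : ∀ {d e} → arc π k ≡ d → d ≢ e → arc π k ≢ e
          differ p d≢e q = d≢e (≡.trans (≡.sym p) q)
          by : ∀ d → arc π k ≡ d → product (weights (insert (suc k) π)) ≈
            descentTerm k + ascentTerm (π⁻¹ k) + loopTerm k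
          by asc  p = trans (product-insert-asc p) (sym (trans
            (+-cong (+-congʳ (descentTerm-vanishes (differ p λ ()))) (loopTerm-vanishes (differ p λ ())))
            (trans (+-identityʳ _) (+-identityˡ _))))
          by desc p = trans (product-insert-desc p) (sym (trans
            (+-cong (+-congˡ (ascentTerm-vanishes (differ p λ ()))) (loopTerm-vanishes (differ p λ ())))
            (trans (+-identityʳ _) (+-identityʳ _))))
          by loop p = trans (product-insert-loop p) (sym (trans
            (+-congʳ (trans (+-cong (descentTerm-vanishes (differ p λ ())) (ascentTerm-vanishes (differ p λ ())))
                            (+-identityˡ 0#)))
            (+-identityˡ _)))

      ∂-product-weights : ∂ (product w) ≈ sum λ k → product (weights (insert (suc k) π))
      ∂-product-weights = begin
        ∂ (product w)
          ≈⟨ ∂-product w ⟩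
        sum (λ i → ∂ (w i) * rest i)
          ≈⟨ sum-cong-≋ (λ i → trans (*-congʳ (∂-letterWeight (arc π i) (arc π (lookup π i))))
               (trans (distribʳ _ _ _) (+-congʳ (distribʳ _ _ _)))) ⟩
        sum (λ i → descentTerm i + ascentTerm i + loopTerm i)
          ≈⟨ trans (∑-distrib-+ _ loopTerm) (+-congʳ (∑-distrib-+ descentTerm ascentTerm)) ⟩
        sum descentTerm + sum ascentTerm + sum loopTerm
          -- The product rule sums over letters, the insertions over arcs. An ascending arc is
          -- charged to the letter it leaves, so this sum is reindexed along the inverse
          -- permutation.
          ≈⟨ +-congʳ (+-congˡ (sum-permute ascentTerm (↔-sym P))) ⟩
        sum descentTerm + sum (ascentTerm ∘ π⁻¹) + sum loopTerm
          ≈⟨ trans (∑-distrib-+ _ loopTerm) (+-congʳ (∑-distrib-+ descentTerm (ascentTerm ∘ π⁻¹))) ⟨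
        sum (λ k → descentTerm k + ascentTerm (π⁻¹ k) + loopTerm k)
          ≈⟨ sum-cong-≋ product-insert ⟨
        sum (λ k → product (weights (insert (suc k) π))) ∎

    total : ∀ {n} → Word n → Carrier
    total π = product (weights π) * D

    -- In the product rule, the derivative of the weights supplies the insertions on arcs, and
    -- `∂ D ≈ Y * D` the insertion as a fixed point.
    ∂-total : ∀ {n} {π : Word n} → π ∈ permutations n →
      ∂ (total π) ≈ listSum (λ k → total (insert k π)) (allFin (suc n))
    ∂-total {n} {π} π∈ = begin
      ∂ (total π)
        ≈⟨ ∂-* _ _ ⟩
      ∂ (product (weights π)) * D + product (weights π) * ∂ D
        ≈⟨ +-cong (*-congʳ (∂-product-weights π π∈)) (*-congˡ ∂D) ⟩
      sum (λ k → product (weights (insert (suc k) π))) * D + product (weights π) * (Y * D)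
        ≈⟨ solve 4 (λ x y z d → x :* d :+ z :* (y :* d) := (y :* z) :* d :+ x :* d) refl _ Y _ D ⟩
      (Y * product (weights π)) * D + sum (λ k → product (weights (insert (suc k) π))) * D
        ≈⟨ +-cong (*-congʳ (sym (product-insert-zero π)))
               (*-distribʳ-sum {n} D (λ k → product (weights (insert (suc k) π)))) ⟩
      sum (λ k → total (insert k π))
        ≈⟨ listSum-tabulate (λ k → total (insert k π)) {suc n} Function.Base.id ⟨
      listSum (λ k → total (insert k π)) (allFin (suc n)) ∎
      where open SemiringSum semiring using (*-distribʳ-sum)

    listSum-permutations : ∀ n → listSum total (permutations n) ≈ fold D ∂ n
    listSum-permutations zero    = trans (+-identityʳ _) (*-identityˡ D)
    listSum-permutations (suc n) = begin
      listSum total (permutations (suc n))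
        ≈⟨ listSum-cartesianProductWith total (flip insert) (permutations n) (allFin (suc n)) ⟩
      listSum (λ π → listSum (λ k → total (insert k π)) (allFin (suc n))) (permutations n)
        ≈⟨ listSum-cong (permutations n) ∂-total ⟨
      listSum (∂ ∘ total) (permutations n)
        ≈⟨ ∂-listSum total (permutations n) ⟨
      ∂ (listSum total (permutations n))
        ≈⟨ ∂-cong (listSum-permutations n) ⟩
      ∂ (fold D ∂ n) ∎

-- Power series and the differential equations

module SeriesDerivative {c ℓ} (R : CommutativeRing c ℓ) where

  open CommutativeRing R hiding (zero)
  open CommutativeMonoidSum +-commutativeMonoid using (sum; sum-cong-≋; sum-replicate-zero; ∑-distrib-+)
  open CommutativeMonoidMult +-commutativeMonoid using (×-distrib-+)
  open SemiringMult semiring using (×-congʳ; ×-homo-+; ×-comm-*; ×-assoc-*; ×-assocˡ) renaming (_×_ to _·_)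
  open PowerSeries R using (Series; const; _≈ˢ_; _*ˢ_; *ˢ-comm; commutativeRing)
  open SetoidReasoning setoid

  -- The Euler operator x d/dx. It preserves degrees, so its product rule involves no index shift;
  -- that of `derivative` follows from it.
  θ : Series → Series
  θ f n = n · f n

  derivative : Series → Series
  derivative f n = θ f (suc n)

  ·-0# : ∀ n → n · 0# ≈ 0#
  ·-0# zero    = refl
  ·-0# (suc n) = trans (+-identityˡ _) (·-0# n)

  ·-sum : ∀ k {n} (f : Fin n → Carrier) → k · sum f ≈ sum (λ i → k · f i)
  ·-sum k {zero}  f = ·-0# k
  ·-sum k {suc n} f = trans (×-distrib-+ _ _ k) (+-congˡ (·-sum k (f ∘ suc)))

  -- In each term of the convolution the degree `n` splits as `i` plus `n ∸ i`, one part for each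
  -- factor.
  θ-* : ∀ f g n → θ (f *ˢ g) n ≈ (θ f *ˢ g) n + (f *ˢ θ g) n
  θ-* f g n = begin
    n · (f *ˢ g) n
      ≈⟨ ·-sum n {suc n} (λ i → f (toℕ i) * g (n ∸ toℕ i)) ⟩
    sum {suc n} (λ i → n · (f (toℕ i) * g (n ∸ toℕ i)))
      ≈⟨ sum-cong-≋ {suc n} (λ i → term (toℕ i) (ℕ.s≤s⁻¹ (Finₚ.toℕ<n i))) ⟩
    sum {suc n} (λ i → θ f (toℕ i) * g (n ∸ toℕ i) + f (toℕ i) * θ g (n ∸ toℕ i))
      ≈⟨ ∑-distrib-+ {suc n} (λ i → θ f (toℕ i) * g (n ∸ toℕ i)) (λ i → f (toℕ i) * θ g (n ∸ toℕ i)) ⟩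
    (θ f *ˢ g) n + (f *ˢ θ g) n ∎
    where
    term : ∀ i → i ℕ.≤ n → n · (f i * g (n ∸ i)) ≈ θ f i * g (n ∸ i) + f i * θ g (n ∸ i)
    term i i≤n = begin
      n · (f i * g (n ∸ i))
        ≡⟨ ≡.cong (_· (f i * g (n ∸ i))) (ℕₚ.m+[n∸m]≡n i≤n) ⟨
      (i ℕ.+ (n ∸ i)) · (f i * g (n ∸ i))
        ≈⟨ ×-homo-+ _ i (n ∸ i) ⟩
      i · (f i * g (n ∸ i)) + (n ∸ i) · (f i * g (n ∸ i))
        ≈⟨ +-cong (×-assoc-* i _ _) (×-comm-* (n ∸ i) _ _) ⟨
      θ f i * g (n ∸ i) + f i * θ g (n ∸ i) ∎

  θ-*-suc : ∀ f g n → (θ f *ˢ g) (suc n) ≈ (derivative f *ˢ g) n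
  θ-*-suc f g n = trans (+-congʳ (zeroˡ _)) (+-identityˡ _)

  open Derivations R using (listSum)
  private module DS = Derivations commutativeRing
  open DS using (IsDerivation)
  open CommutativeMonoidSum *-commutativeMonoid using () renaming (sum to product)
  open CommutativeMonoidSum (CommutativeRing.*-commutativeMonoid commutativeRing)
    using () renaming (sum to productˢ)

  derivative-isDerivation : IsDerivation derivative
  derivative-isDerivation = record
    { ∂-cong = λ f≈g n → ×-congʳ (suc n) (f≈g (suc n))
    ; ∂-+    = λ f g n → ×-distrib-+ _ _ (suc n)
    ; ∂-*    = λ f g n → begin
        derivative (f *ˢ g) n
          ≈⟨ θ-* f g (suc n) ⟩
        (θ f *ˢ g) (suc n) + (f *ˢ θ g) (suc n)
          ≈⟨ +-cong (θ-*-suc f g n)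
               -- `θ-*-suc` lowers the degree on the first factor only, so the product is commuted
               -- before and after.
               (trans (*ˢ-comm f (θ g) (suc n)) (trans (θ-*-suc g f n) (*ˢ-comm (derivative g) f n))) ⟩
        (derivative f *ˢ g) n + (f *ˢ derivative g) n ∎
    }

  -- The case m = 0 recovers the n-th coefficient from the n-th derivative.
  fold-derivative : ∀ f n m → (m !) · fold f derivative n m ≈ ((n ℕ.+ m) !) · f (n ℕ.+ m)
  fold-derivative f zero    m = refl
  fold-derivative f (suc n) m = begin
    (m !) · (suc m · fold f derivative n (suc m))
      ≈⟨ ×-assocˡ _ (m !) (suc m) ⟩
    ((m !) ℕ.* suc m) · fold f derivative n (suc m)
      ≡⟨ ≡.cong (_· fold f derivative n (suc m)) (ℕₚ.*-comm (m !) (suc m)) ⟩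
    (suc m !) · fold f derivative n (suc m)
      ≈⟨ fold-derivative f n (suc m) ⟩
    ((n ℕ.+ suc m) !) · f (n ℕ.+ suc m)
      ≡⟨ ≡.cong (λ k → (k !) · f k) (ℕₚ.+-suc n m) ⟩
    ((suc n ℕ.+ m) !) · f (suc n ℕ.+ m) ∎

  const-*ˢ : ∀ a f n → (const a *ˢ f) n ≈ a * f n
  const-*ˢ a f zero    = +-identityʳ _
  const-*ˢ a f (suc n) = trans (+-congˡ (trans
    (sum-cong-≋ {suc n} λ i → zeroˡ (f (n ∸ toℕ i))) (sum-replicate-zero (suc n)))) (+-identityʳ _)

  product-constant-term : ∀ {n} (f : Fin n → Series) →
    productˢ f 0 ≈ product λ i → f i 0
  product-constant-term {zero}  f = refl
  product-constant-term {suc n} f = trans (+-identityʳ _) (*-congˡ (product-constant-term (f ∘ suc)))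

  listSum-constant-term : ∀ {a} {A : Set a} (f : A → Series) xs →
    DS.listSum f xs 0 ≈ listSum (λ x → f x 0) xs
  listSum-constant-term f []       = refl
  listSum-constant-term f (x ∷ xs) = +-congˡ (listSum-constant-term f xs)

  derivative-const : ∀ a → derivative (const a) ≈ˢ λ _ → 0#
  derivative-const a n = ·-0# (suc n)

-- The differential equations for the letter weights

module Flow {c ℓ} (R : CommutativeRing c ℓ) where

  open CommutativeRing R hiding (zero)
  open Derivations R
  open GroupProperties +-group using (∙-cancelʳ)
  open RingSolver commutativeSemiring using (solve; _:+_; _:*_; _:=_; con)
  open SetoidReasoning setoid

  -- `D` plays the role of 1/(1 - stV). Describing it by its fixpoint equation lets the argument run
  -- in any commutative ring with a derivation.
  module Solution {∂ : Carrier → Carrier} (isDerivation : IsDerivation ∂) (s t u v V D : Carrier)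
    (∂s : ∂ s ≈ 0#) (∂t : ∂ t ≈ 0#) (∂u : ∂ u ≈ 0#) (∂v : ∂ v ≈ 0#)
    (∂∂V : ∂ (∂ V) + s * t * V ≈ 1# + (u + v) * ∂ V) (D-fixpoint : D ≈ 1# + s * t * V * D) where

    open IsDerivation isDerivation

    private
      p h : Carrier
      p = s * t
      h = u + v

    -- `Q` is the right-hand side of the Riccati equation for `K`; as a polynomial in `K` it makes
    -- `T` easy to differentiate.
    K Y Q A B T : Carrier
    K = ∂ V * D
    Y = p * K
    Q = 1# + h * K + p * K * K
    A = u + Y
    B = v + Y
    T = t * Q

    ∂-constant-* : ∀ {a} → ∂ a ≈ 0# → ∀ x → ∂ (a * x) ≈ a * ∂ x
    ∂-constant-* {a} ∂a x = begin
      ∂ (a * x)          ≈⟨ ∂-* a x ⟩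
      ∂ a * x + a * ∂ x  ≈⟨ +-congʳ (trans (*-congʳ ∂a) (zeroˡ x)) ⟩
      0# + a * ∂ x       ≈⟨ +-identityˡ _ ⟩
      a * ∂ x            ∎

    ∂-constant-+ : ∀ {a} → ∂ a ≈ 0# → ∀ x → ∂ (a + x) ≈ ∂ x
    ∂-constant-+ ∂a x = trans (∂-+ _ x) (trans (+-congʳ ∂a) (+-identityˡ _))

    ∂p : ∂ p ≈ 0#
    ∂p = trans (∂-constant-* ∂s t) (trans (*-congˡ ∂t) (zeroʳ s))

    ∂h : ∂ h ≈ 0#
    ∂h = trans (∂-constant-+ ∂u v) ∂v

    -- Differentiating the fixpoint equation gives D′ = pV′D + pVD′. Multiplied by D = 1 + pVD, both
    -- sides contain pVDD′; cancelling it replaces a division by 1 - pV.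
    ∂D : ∂ D ≈ Y * D
    ∂D = ∙-cancelʳ (p * V * D * ∂ D) _ _ (begin
      ∂ D + p * V * D * ∂ D
        ≈⟨ solve 2 (λ a e → e :+ a :* e := (con 1 :+ a) :* e) refl (p * V * D) (∂ D) ⟩
      (1# + p * V * D) * ∂ D
        ≈⟨ *-congʳ D-fixpoint ⟨
      D * ∂ D
        ≈⟨ *-congˡ (begin
             ∂ D                           ≈⟨ ∂-cong D-fixpoint ⟩
             ∂ (1# + p * V * D)            ≈⟨ ∂-constant-+ ∂-1 _ ⟩
             ∂ (p * V * D)                 ≈⟨ ∂-* (p * V) D ⟩
             ∂ (p * V) * D + p * V * ∂ D   ≈⟨ +-congʳ (*-congʳ (∂-constant-* ∂p V)) ⟩
             p * ∂ V * D + p * V * ∂ D     ∎) ⟩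
      D * (p * ∂ V * D + p * V * ∂ D)
        ≈⟨ solve 5 (λ d p v′ v e → d :* (p :* v′ :* d :+ p :* v :* e) :=
                                   p :* (v′ :* d) :* d :+ p :* v :* d :* e)
             refl D p (∂ V) V (∂ D) ⟩
      Y * D + p * V * D * ∂ D ∎)

    -- Multiply the equation for V″ by `D` and expand the lone `D` on the right by its fixpoint
    -- equation; then pVD cancels.
    ∂∂V*D : ∂ (∂ V) * D ≈ 1# + h * K
    ∂∂V*D = ∙-cancelʳ (p * V * D) _ _ (begin
      ∂ (∂ V) * D + p * V * D    ≈⟨ distribʳ D _ _ ⟨
      (∂ (∂ V) + p * V) * D      ≈⟨ *-congʳ ∂∂V ⟩
      (1# + h * ∂ V) * D
        ≈⟨ solve 3 (λ d h v′ → (con 1 :+ h :* v′) :* d := d :+ h :* (v′ :* d)) refl D h (∂ V) ⟩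
      D + h * K                  ≈⟨ +-congʳ D-fixpoint ⟩
      1# + p * V * D + h * K
        ≈⟨ solve 2 (λ a b → con 1 :+ a :+ b := con 1 :+ b :+ a) refl (p * V * D) (h * K) ⟩
      1# + h * K + p * V * D     ∎)

    ∂K : ∂ K ≈ Q
    ∂K = begin
      ∂ (∂ V * D)                    ≈⟨ ∂-* (∂ V) D ⟩
      ∂ (∂ V) * D + ∂ V * ∂ D        ≈⟨ +-cong ∂∂V*D (*-congˡ ∂D) ⟩
      1# + h * K + ∂ V * (Y * D)
        ≈⟨ +-congˡ (solve 3 (λ v′ y d → v′ :* (y :* d) := y :* (v′ :* d)) refl (∂ V) Y D) ⟩
      Q ∎

    ∂Y : ∂ Y ≈ T * s
    ∂Y = begin
      ∂ (p * K)  ≈⟨ ∂-constant-* ∂p K ⟩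
      p * ∂ K    ≈⟨ *-congˡ ∂K ⟩
      p * Q      ≈⟨ solve 3 (λ s t q → s :* t :* q := t :* q :* s) refl s t Q ⟩
      T * s      ∎

    -- By the Riccati equation the derivative of `Q` is (h + 2pK)Q, and h + 2pK is `A + B`.
    ∂T : ∂ T ≈ T * A + T * B
    ∂T = begin
      ∂ (t * Q)
        ≈⟨ ∂-constant-* ∂t Q ⟩
      t * ∂ (1# + h * K + p * K * K)
        ≈⟨ *-congˡ (trans (∂-+ _ _) (+-cong
             (trans (∂-constant-+ ∂-1 _) (trans (∂-constant-* ∂h K) (*-congˡ ∂K)))
             (trans (∂-* _ K) (+-cong (*-congʳ (trans (∂-constant-* ∂p K) (*-congˡ ∂K)))
                                      (*-congˡ ∂K))))) ⟩
      t * (h * Q + (p * Q * K + p * K * Q))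
        ≈⟨ solve 6 (λ t u v q p k →
             t :* ((u :+ v) :* q :+ (p :* q :* k :+ p :* k :* q)) :=
             t :* q :* (u :+ p :* k) :+ t :* q :* (v :+ p :* k)) refl t u v Q p K ⟩
      T * A + T * B ∎

    open Insertion isDerivation A B s T Y D
      (trans (∂-constant-+ ∂u Y) ∂Y) (trans (∂-constant-+ ∂v Y) ∂Y) ∂s ∂T ∂Y ∂D public

-- The series of the theorem

-- `ℚ./` reduces fractions, so the comparison is made among unnormalised ones, where it is a
-- cross-multiplication.
1/m+k/m : ∀ k m .{{_ : ℕ.NonZero m}} → ℤ.1ℤ ℚ./ m ℚ.+ (ℤ.+ k) ℚ./ m ≡ (ℤ.+ suc k) ℚ./ m
1/m+k/m k m@(suc _) = ℚₚ.toℚᵘ-injective (begin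
  ℚ.toℚᵘ (ℤ.1ℤ ℚ./ m ℚ.+ (ℤ.+ k) ℚ./ m)
    ≈⟨ ℚₚ.toℚᵘ-homo-+ (ℤ.1ℤ ℚ./ m) ((ℤ.+ k) ℚ./ m) ⟩
  ℚ.toℚᵘ (ℤ.1ℤ ℚ./ m) ℚᵘ.+ ℚ.toℚᵘ ((ℤ.+ k) ℚ./ m)
    ≈⟨ ℚᵘₚ.+-cong (ℚₚ.toℚᵘ-fromℚᵘ (ℤ.1ℤ ℚᵘ./ m)) (ℚₚ.toℚᵘ-fromℚᵘ ((ℤ.+ k) ℚᵘ./ m)) ⟩
  ℤ.1ℤ ℚᵘ./ m ℚᵘ.+ (ℤ.+ k) ℚᵘ./ m
    ≈⟨ ℚᵘ.*≡* (≡.trans (≡.cong (ℤ._* ℤ.+ m) (≡.sym (ℤₚ.*-distribʳ-+ (ℤ.+ m) ℤ.1ℤ (ℤ.+ k))))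
         (ℤₚ.*-assoc (ℤ.+ suc k) (ℤ.+ m) (ℤ.+ m))) ⟩
  (ℤ.+ suc k) ℚᵘ./ m
    ≈⟨ ℚₚ.toℚᵘ-fromℚᵘ ((ℤ.+ suc k) ℚᵘ./ m) ⟨
  ℚ.toℚᵘ ((ℤ.+ suc k) ℚ./ m) ∎)
  where open SetoidReasoning ℚᵘₚ.≃-setoid

k/km : ∀ k m .{{_ : ℕ.NonZero m}} .{{_ : ℕ.NonZero (suc k ℕ.* m)}} →
  (ℤ.+ suc k) ℚ./ (suc k ℕ.* m) ≡ ℤ.1ℤ ℚ./ m
k/km k m@(suc _) = ℚₚ.fromℚᵘ-cong {(ℤ.+ suc k) ℚᵘ./ (suc k ℕ.* m)} {ℤ.1ℤ ℚᵘ./ m}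
  (ℚᵘ.*≡* (≡.trans (≡.sym (ℤₚ.pos-* (suc k) m)) (≡.sym (ℤₚ.*-identityˡ (ℤ.+ (suc k ℕ.* m))))))

open import Defs

module ℂ = CommutativeRing Coefficients
open ℂ using
  ( _≈_; setoid; refl; sym; trans; reflexive; +-cong; +-congˡ; +-congʳ; *-cong; *-congˡ; *-congʳ
  ; +-identityˡ; +-identityʳ; *-identityˡ; *-identityʳ; zeroˡ; zeroʳ; *-assoc)
open SemiringMult semiring using (×-congʳ; ×-comm-*; ×-assoc-*; ×-assocˡ) renaming (_×_ to _·_)
open SetoidReasoning setoid

opaque
  unfolding Coefficients scalar

  -- The arguments are the exponents of v, u, t and s; away from the constant monomial both sides
  -- compute to zero.
  scalar-0 : scalar ℚ.0ℚ ≈ 0#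
  scalar-0 zero    zero    zero    zero    = ≡.refl
  scalar-0 zero    zero    zero    (suc _) = ≡.refl
  scalar-0 zero    zero    (suc _) _       = ≡.refl
  scalar-0 zero    (suc _) _       _       = ≡.refl
  scalar-0 (suc _) _       _       _       = ≡.refl

  scalar-1 : scalar ℚ.1ℚ ≈ 1#
  scalar-1 = refl {1#}

  scalar-+ : ∀ p q → scalar (p ℚ.+ q) ≈ scalar p + scalar q
  scalar-+ p q zero    zero    zero    zero    = ≡.refl
  scalar-+ p q zero    zero    zero    (suc _) = ≡.refl
  scalar-+ p q zero    zero    (suc _) _       = ≡.refl
  scalar-+ p q zero    (suc _) _       _       = ≡.refl
  scalar-+ p q (suc _) _       _       _       = ≡.refl

·-scalar-1/m : ∀ k m .{{_ : ℕ.NonZero m}} → k · scalar (ℤ.1ℤ ℚ./ m) ≈ scalar ((ℤ.+ k) ℚ./ m)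
·-scalar-1/m zero    m = trans (sym scalar-0) (reflexive (≡.cong scalar (≡.sym (ℚₚ.0/n≡0 m))))
·-scalar-1/m (suc k) m = trans (+-congˡ (·-scalar-1/m k m))
  (trans (sym (scalar-+ (ℤ.1ℤ ℚ./ m) ((ℤ.+ k) ℚ./ m))) (reflexive (≡.cong scalar (1/m+k/m k m))))

-- This is why differentiating an `egf` shifts its sequence by one.
·-1/! : ∀ n → suc n · scalar (1/ suc n !) ≈ scalar (1/ n !)
·-1/! n = trans (·-scalar-1/m (suc n) (suc n !)) (reflexive (≡.cong scalar (k/km n (n !))))
  where instance _ = n ℕₚ.!≢0
                 _ = suc n ℕₚ.!≢0

!·1/! : ∀ n → (n !) · scalar (1/ n !) ≈ 1#
!·1/! zero    = trans (+-identityʳ _) scalar-1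
!·1/! (suc n) = begin
  (suc n ℕ.* (n !)) · scalar (1/ suc n !)   ≡⟨ ≡.cong (_· scalar (1/ suc n !)) (ℕₚ.*-comm (suc n) (n !)) ⟩
  ((n !) ℕ.* suc n) · scalar (1/ suc n !)   ≈⟨ ×-assocˡ _ (n !) (suc n) ⟨
  (n !) · (suc n · scalar (1/ suc n !))     ≈⟨ ×-congʳ (n !) (·-1/! n) ⟩
  (n !) · scalar (1/ n !)                   ≈⟨ !·1/! n ⟩
  1#                                      ∎

2*½ : 2# * ½ ≈ 1#
2*½ = begin
  2# * ½                   ≈⟨ *-congʳ (trans (scalar-+ ℚ.1ℚ ℚ.1ℚ) (+-cong scalar-1 scalar-1)) ⟩
  (1# + 1#) * ½            ≈⟨ ℂ.distribʳ ½ 1# 1# ⟩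
  1# * ½ + 1# * ½          ≈⟨ +-cong (*-identityˡ ½) (*-identityˡ ½) ⟩
  ½ + ½                    ≈⟨ scalar-+ ℚ.½ ℚ.½ ⟨
  scalar (ℚ.½ ℚ.+ ℚ.½)     ≈⟨ scalar-1 ⟩
  1#                       ∎

-- The differential equation for V and the fixpoint equation for its reciprocal series

open SeriesDerivative Coefficients
open PowerSeries Coefficients using (commutativeRing)
private module ℂ⟦x⟧ = CommutativeRing commutativeRing

·-1/!-* : ∀ n x → suc n · (scalar (1/ suc n !) * x) ≈ scalar (1/ n !) * x
·-1/!-* n x = trans (sym (×-assoc-* (suc n) (scalar (1/ suc n !)) x)) (*-congʳ (·-1/! n))

-- The Chebyshev sequence continued one step down by the value 0, which the recurrence assigns to
-- index -1.
U₋₁ : ℚ[s,t,u,v] → ℚ[s,t,u,v] → ℕ → ℚ[s,t,u,v]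
U₋₁ a b zero    = 0#
U₋₁ a b (suc n) = U n a b

derivative-V : ∀ a b → derivative (V a b) ≈ˢ egf (U₋₁ a b)
derivative-V a b zero    = ·-1/!-* 0 0#
derivative-V a b (suc n) = ·-1/!-* (suc n) (U n a b)

derivative²-V : ∀ a b → derivative (derivative (V a b)) ≈ˢ egf λ n → U n a b
derivative²-V a b n =
  trans (×-congʳ (suc n) (derivative-V a b (suc n))) (·-1/!-* n (U n a b))

const-+ : ∀ a b → const (a + b) ≈ˢ const a +ˢ const b
const-+ a b zero    = refl
const-+ a b (suc n) = sym (+-identityˡ 0#)

const-* : ∀ a b → const a *ˢ const b ≈ˢ const (a * b)
const-* a b zero    = const-*ˢ a (const b) zero
const-* a b (suc n) = trans (const-*ˢ a (const b) (suc n)) (zeroʳ a)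

p b h : ℚ[s,t,u,v]
p = s * t
b = ½ * (u + v)
h = u + v

W G : ℚ[s,t,u,v]⟦x⟧
W  = const p *ˢ V p b
G = recip (1ˢ -ˢ W)

2b≈h : 2# * b ≈ h
2b≈h = trans (sym (*-assoc _ _ _)) (trans (*-congʳ 2*½) (*-identityˡ h))

open RingSolver ℂ.commutativeSemiring using (solve; _:+_; _:*_; _:=_; con)

-- The sequences of V, V′ and V″ are successive shifts of the Chebyshev polynomials, so from degree
-- 2 on this is their recurrence with 2b = h. Degrees 0 and 1 carry the initial values, and degree 0
-- the summand 1.
V-equation-coefficients : ∀ n → derivative (derivative (V p b)) n + p * V p b n ≈
  1ˢ n + h * derivative (V p b) n
V-equation-coefficients n = trans (+-congʳ (derivative²-V p b n))
  (trans (go n) (+-congˡ (*-congˡ (sym (derivative-V p b n)))))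
  where
  go : ∀ n → scalar (1/ n !) * U n p b + p * V p b n ≈
    1ˢ n + h * egf (U₋₁ p b) n
  go zero = begin
    x * 1# + p * (x * 0#)
      ≈⟨ +-cong (trans (*-identityʳ x) scalar-1) (*-congˡ (zeroʳ x)) ⟩
    1# + p * 0#
      ≈⟨ +-congˡ (trans (zeroʳ p) (sym (trans (*-congˡ (zeroʳ x)) (zeroʳ h)))) ⟩
    1# + h * (x * 0#) ∎
    where x = scalar (1/ 0 !)
  go (suc zero) = begin
    x * (2# * b) + p * (x * 0#)
      ≈⟨ +-cong (*-congˡ 2b≈h) (trans (*-congˡ (zeroʳ x)) (zeroʳ p)) ⟩
    x * h + 0#
      ≈⟨ solve 2 (λ x h → x :* h :+ con 0 := con 0 :+ h :* (x :* con 1)) refl x h ⟩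
    0# + h * (x * 1#) ∎
    where x = scalar (1/ 1 !)
  go (suc (suc n)) = begin
    x * (2# * b * U₁ - p * U₀) + p * (x * U₀)
      ≈⟨ solve 5 (λ x c m p u₀ → x :* (c :+ m) :+ p :* (x :* u₀) := x :* (c :+ (m :+ p :* u₀)))
           refl x (2# * b * U₁) (ℂ.- (p * U₀)) p U₀ ⟩
    x * (2# * b * U₁ + (ℂ.- (p * U₀) + p * U₀))
      ≈⟨ *-congˡ (trans (+-congˡ (ℂ.-‿inverseˡ _)) (trans (+-identityʳ _) (*-congʳ 2b≈h))) ⟩
    x * (h * U₁)
      ≈⟨ solve 3 (λ x h u₁ → x :* (h :* u₁) := con 0 :+ h :* (x :* u₁)) refl x h U₁ ⟩
    0# + h * (x * U₁) ∎
    where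
    x = scalar (1/ suc (suc n) !)
    U₀ = U n p b
    U₁ = U (suc n) p b

V-equation : derivative (derivative (V p b)) +ˢ const s *ˢ const t *ˢ V p b ≈ˢ
  1ˢ +ˢ (const u +ˢ const v) *ˢ derivative (V p b)
V-equation n = begin
  derivative (derivative (V p b)) n + (const s *ˢ const t *ˢ V p b) n
    ≈⟨ +-congˡ (trans (ℂ⟦x⟧.*-congʳ {V p b} (const-* s t) n) (const-*ˢ p (V p b) n)) ⟩
  derivative (derivative (V p b)) n + p * V p b n
    ≈⟨ V-equation-coefficients n ⟩
  1ˢ n + h * derivative (V p b) n
    ≈⟨ +-congˡ (trans (sym (const-*ˢ h (derivative (V p b)) n))
                      (ℂ⟦x⟧.*-congʳ {derivative (V p b)} (const-+ u v) n)) ⟩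
  1ˢ n + ((const u +ˢ const v) *ˢ derivative (V p b)) n ∎

-- This is (1 - W)G = 1 with the product WG moved to the right.
G-fixpoint : G ≈ˢ 1ˢ +ˢ const s *ˢ const t *ˢ V p b *ˢ G
G-fixpoint = S.begin
  G                             S.≈⟨ S+.//-rightDividesˡ (W *ˢ G) G ⟨
  (G -ˢ W *ˢ G) +ˢ W *ˢ G
    S.≈⟨ ℂ⟦x⟧.+-congʳ (ℂ⟦x⟧.+-cong (ℂ⟦x⟧.sym (ℂ⟦x⟧.*-identityˡ G)) (SR.-‿distribˡ-* W G)) ⟩
  (1ˢ *ˢ G +ˢ (ℂ⟦x⟧.- W) *ˢ G) +ˢ W *ˢ G
    S.≈⟨ ℂ⟦x⟧.+-congʳ (ℂ⟦x⟧.distribʳ G 1ˢ (ℂ⟦x⟧.- W)) ⟨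
  (1ˢ -ˢ W) *ˢ G +ˢ W *ˢ G
    S.≈⟨ ℂ⟦x⟧.+-cong (recip-inverseʳ (1ˢ -ˢ W) (1-aV-constant-term p p b))
          (ℂ⟦x⟧.*-congʳ {G} (ℂ⟦x⟧.*-congʳ {V p b} (ℂ⟦x⟧.sym (const-* s t)))) ⟩
  1ˢ +ˢ const s *ˢ const t *ˢ V p b *ˢ G S.∎
  where
  module S = SetoidReasoning ℂ⟦x⟧.setoid
  module S+ = GroupProperties ℂ⟦x⟧.+-group
  module SR = RingProperties ℂ⟦x⟧.ring

open Flow.Solution commutativeRing derivative-isDerivation
  (const s) (const t) (const u) (const v) (V p b) G (derivative-const s) (derivative-const t) (derivative-const u) (derivative-const v)
  V-equation G-fixpoint using (K; Y; A; B; T; letterWeight; weights; total; listSum-permutations)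

open Derivations Coefficients
  using (listSum; listSum-cong; listSum-↭; listSum-filter; product-split; productExcept)
open CommutativeMonoidSum ℂ.*-commutativeMonoid using ()
  renaming (sum to product; sum-cong-≋ to product-cong; ∑-distrib-+ to product-*)

-- Letter weights at x = 0

*ˢ-vanishes₀ʳ : ∀ {f g} → g 0 ≈ 0# → (f *ˢ g) 0 ≈ 0#
*ˢ-vanishes₀ʳ {f} g₀≈0 = trans (+-identityʳ _) (trans (*-congˡ {f 0} g₀≈0) (zeroʳ (f 0)))

-- `V` starts in degree 2, so its derivative vanishes at x = 0.
K₀ : K 0 ≈ 0#
K₀ = trans (+-identityʳ _) (trans (*-congʳ (trans (derivative-V p b 0) (zeroʳ _))) (zeroˡ _))

Y₀ : Y 0 ≈ 0#
Y₀ = *ˢ-vanishes₀ʳ {const s *ˢ const t} {K} K₀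

A₀ : A 0 ≈ u
A₀ = trans (+-congˡ Y₀) (+-identityʳ u)

B₀ : B 0 ≈ v
B₀ = trans (+-congˡ Y₀) (+-identityʳ v)

-- Since `K` vanishes at x = 0, only the summand 1 of the Riccati polynomial remains.
T₀ : T 0 ≈ t
T₀ = trans (+-identityʳ _) (trans (*-congˡ (trans
  (+-cong (trans (+-congˡ (*ˢ-vanishes₀ʳ {const u +ˢ const v} {K} K₀)) (+-identityʳ 1#))
          (*ˢ-vanishes₀ʳ {const s *ˢ const t *ˢ K} {K} K₀))
  (+-identityʳ 1#))) (*-identityʳ t))

-- Cyclic statistics as products over letters

ascends descends : Direction → Bool
ascends asc   = true
ascends _     = false
descends desc = true
descends _    = false

does-<? : ∀ {m n} (i : Fin m) (j : Fin n) → does (i Finₚ.<? j) ≡ ascends (direction i j)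
does-<? zero    zero    = ≡.refl
does-<? zero    (suc j) = ≡.refl
does-<? (suc i) zero    = ≡.refl
does-<? (suc i) (suc j) = does-<? i j

does->? : ∀ {m n} (i : Fin m) (j : Fin n) → does (j Finₚ.<? i) ≡ descends (direction i j)
does->? zero    zero    = ≡.refl
does->? zero    (suc j) = ≡.refl
does->? (suc i) zero    = ≡.refl
does->? (suc i) (suc j) = does->? i j

-- Spreads a counting exponent over one factor per index, ready for comparison with the letter
-- weights.
power-count : ∀ {a ℓ} {X : Set a} {P : X → Set ℓ} (P? : Decidable P) x {n} (f : Fin n → X) →
  x ^ length (filter P? (List.tabulate f)) ≈ product λ i → if does (P? (f i)) then x else 1#
power-count P? x {zero}  f = refl
power-count P? x {suc n} f with does (P? (f zero))
... | true  = *-congˡ (power-count P? x (f ∘ suc))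
... | false = trans (power-count P? x (f ∘ suc)) (sym (*-identityˡ _))

letterMonomial : Direction → Direction → ℚ[s,t,u,v]
letterMonomial d e =
  (if ascends d ∧ descends e then s else 1#) * (if descends d ∧ ascends e then t else 1#) *
  (if ascends d ∧ ascends e then u else 1#) * (if descends d ∧ descends e then v else 1#)

-- Without loops exactly one of the four tests succeeds, and its variable is the constant term of
-- the corresponding weight.
letterMonomial≈letterWeight : ∀ {d e} → d ≢ loop → e ≢ loop → letterMonomial d e ≈ letterWeight d e 0
letterMonomial≈letterWeight {asc} {asc} _ _ = trans
  (solve 1 (λ x → con 1 :* con 1 :* x :* con 1 := x) refl u) (sym A₀)
letterMonomial≈letterWeight {asc} {desc} _ _ =
  solve 1 (λ x → x :* con 1 :* con 1 :* con 1 := x) refl s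
letterMonomial≈letterWeight {desc} {asc} _ _ = trans
  (solve 1 (λ x → con 1 :* x :* con 1 :* con 1 := x) refl t) (sym T₀)
letterMonomial≈letterWeight {desc} {desc} _ _ = trans
  (solve 1 (λ x → con 1 :* con 1 :* con 1 :* x := x) refl v) (sym B₀)
letterMonomial≈letterWeight {loop} d≢ _ = contradiction ≡.refl d≢
letterMonomial≈letterWeight {asc}  {loop} _ e≢ = contradiction ≡.refl e≢
letterMonomial≈letterWeight {desc} {loop} _ e≢ = contradiction ≡.refl e≢

total₀ : ∀ {n} (π : Word n) → total π 0 ≈ product λ i → weights π i 0
-- The factor `G 0` is `1#` by the definition of `recip`.
total₀ π = trans (+-identityʳ _) (trans (*-identityʳ _) (product-constant-term (weights π)))

weight≈total₀ : ∀ {n} {π : Word n} → IsDerangement π → weight π ≈ total π 0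
weight≈total₀ {n} {π} (_ , fixfree) = begin
  s ^ cpk π * t ^ cval π * u ^ cdasc π * v ^ cddes π
    ≈⟨ *-cong (*-cong (*-cong (power-count (cyclicPeak? π) s id) (power-count (cyclicValley? π) t id))
         (power-count (cyclicDoubleAscent? π) u id)) (power-count (cyclicDoubleDescent? π) v id) ⟩
  product fs * product ft * product fu * product fv
    ≈⟨ trans (product-* _ fv) (*-congʳ (trans (product-* _ fu) (*-congʳ (product-* fs ft)))) ⟨
  product (λ i → fs i * ft i * fu i * fv i)
    ≈⟨ product-cong (λ i → trans (reflexive (monomial i))
         (letterMonomial≈letterWeight (no-loop i) (no-loop (lookup π i)))) ⟩
  product (λ i → weights π i 0)
    ≈⟨ total₀ π ⟨
  total π 0 ∎
  where
  fs ft fu fv : Fin n → ℚ[s,t,u,v]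
  fs i = if does (cyclicPeak? π i) then s else 1#
  ft i = if does (cyclicValley? π i) then t else 1#
  fu i = if does (cyclicDoubleAscent? π i) then u else 1#
  fv i = if does (cyclicDoubleDescent? π i) then v else 1#
  no-loop : ∀ i → arc π i ≢ loop
  no-loop i eq = fixfree i (≡.sym (loop⇒≡ i (lookup π i) eq))
  monomial : ∀ i → fs i * ft i * fu i * fv i ≡ letterMonomial (arc π i) (arc π (lookup π i))
  monomial i
    rewrite does-<? i (lookup π i) | does->? i (lookup π i)
          | does-<? (lookup π i) (lookup π (lookup π i)) | does->? (lookup π i) (lookup π (lookup π i))
    = ≡.refl

-- A fixed letter has weight `Y`, which vanishes at x = 0.
total₀-fixedPoint : ∀ {n} (π : Word n) i → lookup π i ≡ i → total π 0 ≈ 0#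
total₀-fixedPoint π i πi≡i = begin
  total π 0                          ≈⟨ total₀ π ⟩
  product w                          ≈⟨ product-split w i ⟩
  w i * productExcept w i            ≈⟨ *-congʳ (trans (reflexive w-i) Y₀) ⟩
  0# * productExcept w i             ≈⟨ zeroˡ _ ⟩
  0#                                 ∎
  where
  w = λ j → weights π j 0
  i-loop : arc π i ≡ loop
  i-loop = ≡.trans (≡.cong (direction i) πi≡i) (direction-refl i)
  w-i : w i ≡ Y 0
  w-i = ≡.cong₂ (λ d e → letterWeight d e 0) i-loop (≡.trans (≡.cong (arc π) πi≡i) i-loop)

-- From permutations to derangements

∈-permutations⇒IsPermutation : ∀ {n} {π : Word n} → π ∈ permutations n → IsPermutation π
∈-permutations⇒IsPermutation π∈ =
  proj₁ (∈-permutations⁻ π∈) , strictlySurjective⇒surjective (proj₂ (∈-permutations⁻ π∈))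

-- Two lists without repetitions and with the same members are rearrangements of each other.
derangements↭ : ∀ n → derangements n ↭ filter isDerangement? (permutations n)
derangements↭ n = ∼bag⇒↭ (unique∧set⇒bag (derangements-unique n)
  (Uniqueₚ.filter⁺ isDerangement? (permutations-unique n)) (mk⇔ to from))
  where
  to : ∀ {π} → π ∈ derangements n → π ∈ filter isDerangement? (permutations n)
  to π∈ with Equivalence.to ∈-derangements π∈
  ... | der@((inj , sur) , _) =
    ∈-filter⁺ isDerangement? (∈-permutations⁺ (inj , surjective⇒strictlySurjective sur)) der
  from : ∀ {π} → π ∈ filter isDerangement? (permutations n) → π ∈ derangements n
  from π∈ = Equivalence.from ∈-derangements
    (proj₂ (∈-filter⁻ isDerangement? {xs = permutations n} π∈))

total₀-nonDerangement : ∀ {n} {π : Word n} → π ∈ permutations n → ¬ IsDerangement π → total π 0 ≈ 0#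
total₀-nonDerangement {π = π} π∈ ¬der = total₀-fixedPoint π i πi≡i
  where
  fixedPoint : ∃ λ i → lookup π i ≡ i
  fixedPoint = decidable-stable (Finₚ.any? λ i → lookup π i Finₚ.≟ i) λ fixfree →
    ¬der (∈-permutations⇒IsPermutation π∈ , λ i eq → fixfree (i , eq))
  i = proj₁ fixedPoint
  πi≡i = proj₂ fixedPoint

-- Permutations with fixed points contribute zero at x = 0, so the sum extends to all permutations,
-- where it is the n-th derivative of `G` at x = 0.
listSum-weight : ∀ n → listSum weight (derangements n) ≈ (n !) · G n
listSum-weight n = begin
  listSum weight (derangements n)
    ≈⟨ listSum-cong (derangements n) (λ {π} π∈ → weight≈total₀ {π = π} (Equivalence.to ∈-derangements π∈)) ⟩
  listSum (λ π → total π 0) (derangements n)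
    ≈⟨ listSum-↭ _ (derangements↭ n) ⟩
  listSum (λ π → total π 0) (filter isDerangement? (permutations n))
    ≈⟨ listSum-filter isDerangement? _ (permutations n) total₀-nonDerangement ⟩
  listSum (λ π → total π 0) (permutations n)
    ≈⟨ listSum-constant-term total (permutations n) ⟨
  Derivations.listSum commutativeRing total (permutations n) 0
    ≈⟨ listSum-permutations n 0 ⟩
  fold G derivative n 0
    -- The factor `1` is `0 !`, as `fold-derivative` has it for `m` = 0.
    ≈⟨ +-identityʳ _ ⟨
  1 · fold G derivative n 0
    ≈⟨ fold-derivative G n 0 ⟩
  ((n ℕ.+ 0) !) · G (n ℕ.+ 0)
    ≡⟨ ≡.cong (λ k → (k !) · G k) (ℕₚ.+-identityʳ n) ⟩
  (n !) · G n ∎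

theorem8 : D ≈ˢ recip (1ˢ -ˢ const (s * t) *ˢ V (s * t) (½ * (u + v)))
-- `D` has constant term 1 by a separate clause, and `recip` by definition.
theorem8 zero    = trans (*-identityʳ _) scalar-1
theorem8 (suc n) = begin
  x * listSum weight (derangements (suc n))  ≈⟨ *-congˡ (listSum-weight (suc n)) ⟩
  x * ((suc n !) · G (suc n))               ≈⟨ ×-comm-* (suc n !) x _ ⟩
  (suc n !) · (x * G (suc n))               ≈⟨ ×-assoc-* (suc n !) x _ ⟨
  (suc n !) · x * G (suc n)                 ≈⟨ *-congʳ (!·1/! (suc n)) ⟩
  1# * G (suc n)                            ≈⟨ *-identityˡ _ ⟩
  G (suc n)                                 ∎
  where x = scalar (1/ suc n !)
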